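{- Let $a,b,c$ be positive integers, $\rho=(a^b)$ and $N=b+c$. Let $T$ be a uniformly random lozenge tiling of the hexagon with sides $(a,b,c,a,b,c)$ and let $\Gamma_\ell$ be the number of left corners of $T$ of height $\ell$, $\ell\in[1,c]$. Then $$\sum_{\gamma\in\mathbb N^c}\mathrm P(\Gamma_1=\gamma_1,\dots,\Gamma_c=\gamma_c)\,x_1^{\gamma_1}\cdots x_c^{\gamma_c}=S_\rho(x_1,\dots,x_c;N)=\frac{s_{(a^b)}(1^b,x_1,\dots,x_c)}{s_{(a^b)}(1^{b+c})}.$$
   Context: Lozenge tilings of the hexagon with sides $(a,b,c,a,b,c)$ are in bijection with plane partitions $\pi$ (arrays of nonnegative integers weakly decreasing along rows and columns) with at most $b$ nonzero rows, at most $a$ nonzero columns and entries at most $c$, viewing $\pi$ as a pile of unit cubes whose visible surface is the tiling. A left corner is the visible corner of a cube (a top lozenge with the left and right lozenges directly below it), and its height is the $z$-coordinate of its top lozenge; under the bijection, $\Gamma_\ell$ equals the number of columns of $\pi$ containing the entry $\ell$. $s_\lambda$ is the Schur polynomial, $1^m$ denotes $m$ variables equal to $1$, and the normalized Schur polynomial is $S_\lambda(x_1,\dots,x_k;N)=s_\lambda(x_1,\dots,x_k,1^{N-k})/s_\lambda(1^N)$. -}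

module Defs where

import Agda.Primitive
open import Data.Nat.ListAction using (sum)
open import Data.Nat using (ℕ; zero; suc; _+_)
open import Data.Fin using (Fin; zero; suc; _↑ʳ_) renaming (_≤_ to _≤ᶠ_; _<_ to _<ᶠ_)
open import Data.Fin.Properties using (all?; any?; _≟_) renaming (_≤?_ to _≤ᶠ?_; _<?_ to _<ᶠ?_)
open import Data.List using (List; []; _∷_; map; concatMap; length; filter; allFin)
open import Data.Vec.Functional using () renaming (_∷_ to _∷ᶠ_)
open import Data.Product using (∃; _,_)
open import Data.Integer using (+_)
open import Data.Rational using (ℚ; _/_; 0ℚ)
open import Relation.Nullary using (Dec)
open import Relation.Nullary.Decidable using (_→-dec_; _×-dec_)
open import Relation.Unary using (Pred; Decidable)
open import Relation.Binary.PropositionalEquality using (_≡_)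

allFuns : ∀ {A : Set} (n : ℕ) → List A → List (Fin n → A)
allFuns zero    xs = (λ ()) ∷ []
allFuns (suc n) xs = concatMap (λ f → map (λ x → x ∷ᶠ f) xs) (allFuns n xs)

allArrays : (r s m : ℕ) → List (Fin r → Fin s → Fin m)
allArrays r s m = allFuns r (allFuns s (allFin m))

count : ∀ {A : Set} {P : Pred A Agda.Primitive.lzero} → Decidable P → List A → ℕ
count P? xs = length (filter P? xs)

countFin : ∀ {n} {P : Pred (Fin n) Agda.Primitive.lzero} → Decidable P → ℕ
countFin {n} P? = count P? (allFin n)

-- the rational number m/n (with the convention m/0 = 0, never used here)
frac : ℕ → ℕ → ℚ
frac m zero    = 0ℚ
frac m (suc n) = (+ m) / suc n

-- Plane partitions in the a × b × c box (⇔ lozenge tilings of the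
-- (a,b,c,a,b,c) hexagon).  An array π with b rows, a columns and
-- entries in {0,…,c}, weakly decreasing along rows and columns.

Array : (r s m : ℕ) → Set
Array r s m = Fin r → Fin s → Fin m

IsPlanePartition : ∀ {r s m} → Array r s m → Set
IsPlanePartition π =
  (∀ i j j' → j ≤ᶠ j' → π i j' ≤ᶠ π i j) Data.Product.×
  (∀ i i' j → i ≤ᶠ i' → π i' j ≤ᶠ π i j)

isPlanePartition? : ∀ {r s m} → Decidable (IsPlanePartition {r} {s} {m})
isPlanePartition? π =
  all? (λ i → all? (λ j → all? (λ j' → (j ≤ᶠ? j') →-dec (π i j' ≤ᶠ? π i j))))
  ×-dec
  all? (λ i → all? (λ i' → all? (λ j → (i ≤ᶠ? i') →-dec (π i' j ≤ᶠ? π i j))))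

planePartitions : (a b c : ℕ) → List (Array b a (suc c))
planePartitions a b c = filter isPlanePartition? (allArrays b a (suc c))

-- Γ_ℓ(π) = number of columns of π containing the entry ℓ, ℓ ∈ [1,c];
-- ℓ is encoded by ℓ' : Fin c with ℓ = suc ℓ'.
Γ : ∀ {a b c} → Array b a (suc c) → Fin c → ℕ
Γ π ℓ = countFin (λ j → any? (λ i → π i j ≟ suc ℓ))

ΓIs : ∀ {a b c} → (Fin c → ℕ) → Array b a (suc c) → Set
ΓIs γ π = ∀ ℓ → Γ π ℓ ≡ γ ℓ

ΓIs? : ∀ {a b c} (γ : Fin c → ℕ) → Decidable (ΓIs {a} {b} {c} γ)
ΓIs? γ π = all? (λ ℓ → Γ π ℓ Data.Nat.≟ γ ℓ)

probΓ : (a b c : ℕ) → (Fin c → ℕ) → ℚ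
probΓ a b c γ = frac (count (ΓIs? γ) (planePartitions a b c))
                     (length (planePartitions a b c))

-- Schur polynomials of rectangular shape (a^b) in N variables,
-- via semistandard Young tableaux: s_λ(y) = Σ_T ∏_{cells} y_{T(cell)}.
-- A tableau of shape (a^b) with entries in {1,…,N} is an array with
-- b rows, a columns, entries in Fin N, weakly increasing along rows,
-- strictly increasing down columns.

IsSSYT : ∀ {r s m} → Array r s m → Set
IsSSYT T =
  (∀ i j j' → j ≤ᶠ j' → T i j ≤ᶠ T i j') Data.Product.×
  (∀ i i' j → i <ᶠ i' → T i j <ᶠ T i' j)

isSSYT? : ∀ {r s m} → Decidable (IsSSYT {r} {s} {m})
isSSYT? T =
  all? (λ i → all? (λ j → all? (λ j' → (j ≤ᶠ? j') →-dec (T i j ≤ᶠ? T i j'))))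
  ×-dec
  all? (λ i → all? (λ i' → all? (λ j → (i <ᶠ? i') →-dec (T i j <ᶠ? T i' j))))

SSYTs : (a b N : ℕ) → List (Array b a N)
SSYTs a b N = filter isSSYT? (allArrays b a N)

content : ∀ {r s m} → Array r s m → Fin m → ℕ
content {r} {s} T k =
  sum (Data.List.map (λ i → countFin (λ j → T i j ≟ k)) (allFin r))

-- Coefficient of x_1^{γ_1}⋯x_c^{γ_c} in s_{(a^b)}(1^b, x_1, …, x_c):
-- the letters 1..b carry the variables set to 1, the letter b+ℓ carries x_ℓ.
ContentIs : ∀ {a b c} → (Fin c → ℕ) → Array b a (b + c) → Set
ContentIs {b = b} γ T = ∀ ℓ → content T (b ↑ʳ ℓ) ≡ γ ℓ

ContentIs? : ∀ {a b c} (γ : Fin c → ℕ) → Decidable (ContentIs {a} {b} {c} γ)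
ContentIs? {b = b} γ T = all? (λ ℓ → content T (b ↑ʳ ℓ) Data.Nat.≟ γ ℓ)

schurSpecCoeff : (a b c : ℕ) → (Fin c → ℕ) → ℕ
schurSpecCoeff a b c γ = count (ContentIs? γ) (SSYTs a b (b + c))

schurAtOnes : (a b N : ℕ) → ℕ
schurAtOnes a b N = length (SSYTs a b N)

normSchurCoeff : (a b c : ℕ) → (Fin c → ℕ) → ℚ
normSchurCoeff a b c γ = frac (schurSpecCoeff a b c γ) (schurAtOnes a b (b + c))

{-# OPTIONS --safe #-}
-- Conjugating every row turns a plane partition π into the array P x k = #{ y ∣ π x y > k }, and
-- P is the array of last-passage times of the matrix weight P, whose k-th column sum is Γ (k + 1).
-- A rectangular tableau T is likewise a plane partition (subtract the row index and rotate by a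
-- half turn), and its content at the letter b + k + 1 is the difference of two consecutive
-- diagonal sums of its conjugated array.  The Robinson–Schensted–Knuth correspondence, realised
-- by piecewise-linear toggles of the interior entries along diagonals, is a bijection of such arrays
-- that carries column sums of the weights to these differences and respects the size of the box,
-- because each toggle is an involution fixing the first row and the first column.
module Submission where

open import Defs
open import Data.Nat using (ℕ; zero; suc; _+_; _∸_; _⊓_; _⊔_; _≤_; _<_; z≤n; s≤s; s≤s⁻¹; _≤?_; _<?_; _≟_)
open import Data.Nat.Properties hiding (_≤?_; _<?_; _≟_)
open import Data.Nat.ListAction using (sum)
open import Data.Nat.Tactic.RingSolver using (solve-∀)
open import Data.Bool using (true; false; if_then_else_)
open import Data.Empty using (⊥-elim)
open import Data.Fin using (Fin; zero; suc; toℕ; fromℕ; fromℕ<; opposite; _↑ʳ_) renaming (_≤_ to _≤ᶠ_; _<_ to _<ᶠ_)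
import Data.Fin.Properties as Fin
open import Data.List using (List; []; _∷_; tabulate; allFin; map; filter; length; lookup; concatMap; cartesianProductWith)
open import Data.List.Properties using (map-cong; filter-≐)
open import Data.List.Relation.Unary.All as All using (All; []; _∷_)
import Data.List.Relation.Unary.All.Properties as All
open import Data.List.Relation.Unary.Any using (here; index)
open import Data.List.Relation.Unary.AllPairs using ([]; _∷_)
import Data.List.Membership.Setoid as Membership
import Data.List.Membership.Setoid.Properties as Membershipₚ
open import Data.List.Membership.Propositional.Properties using (∈-allFin; ∈-lookup)
import Data.List.Relation.Unary.Unique.Setoid as Unique
import Data.List.Relation.Unary.Unique.Setoid.Properties as Uniqueₚ
import Data.Vec.Functional as Vector
open import Data.Vec.Functional.Relation.Binary.Equality.Setoid using (≋-setoid)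
open import Data.Unit using (⊤; tt)
open import Level using (0ℓ)
open import Relation.Binary.Bundles using (Setoid)
open import Relation.Binary.Definitions using (_Respects_; tri<; tri≈; tri>)
open import Relation.Unary using (Decidable)
open import Relation.Binary.PropositionalEquality
  using (_≡_; refl; sym; trans; cong; cong₂; subst; subst₂; setoid; module ≡-Reasoning)
open import Data.Fin.Properties using
  ( toℕ<n; toℕ-injective; toℕ-fromℕ<; toℕ-fromℕ; toℕ-↑ʳ; opposite-prop; opposite-involutive
  ; injective⇒≤; any? )
open import Data.Product using (_×_; _,_; proj₂; ∃)
open import Data.Sum using (_⊎_; inj₁; inj₂)
open import Relation.Nullary using (Dec; yes; no; ¬_; ¬?; does)
open import Relation.Nullary.Decidable using (_×-dec_; dec-true; dec-false; does-⇔)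
open import Function using (_∘_; id; _⇔_; mk⇔; Equivalence)
open Equivalence using () renaming (to to ⇒; from to ⇐)

-- Finite sums over initial segments of the naturals.

∑ : ℕ → (ℕ → ℕ) → ℕ
∑ zero    f = 0
∑ (suc n) f = f 0 + ∑ n (f ∘ suc)

∑-cong : ∀ n {f g : ℕ → ℕ} → (∀ i → i < n → f i ≡ g i) → ∑ n f ≡ ∑ n g
∑-cong zero    f≡g = refl
∑-cong (suc n) f≡g = cong₂ _+_ (f≡g 0 (s≤s z≤n)) (∑-cong n λ i i<n → f≡g (suc i) (s≤s i<n))

∑-last : ∀ n f → ∑ (suc n) f ≡ ∑ n f + f n
∑-last zero    f = +-comm (f 0) 0
∑-last (suc n) f = trans (cong (f 0 +_) (∑-last n (f ∘ suc))) (sym (+-assoc (f 0) _ _))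

-- Boxed grids and piecewise-linear toggles.

Grid : Set
Grid = ℕ → ℕ → ℕ

infix 4 _≐_
_≐_ : Grid → Grid → Set
P ≐ Q = ∀ x y → P x y ≡ Q x y

-- A plane partition in a `b` by `w` by `h` box, extended by zeros to the whole quadrant so that
-- right and lower neighbours always exist.
record Boxed (b w h : ℕ) (P : Grid) : Set where
  field
    row-anti : ∀ x y → P x (suc y) ≤ P x y
    col-anti : ∀ x y → P (suc x) y ≤ P x y
    below    : ∀ x y → b ≤ x → P x y ≡ 0
    right    : ∀ x y → w ≤ y → P x y ≡ 0
    bound    : ∀ x y → P x y ≤ h

open Boxed

-- Indexed differently: ceiling P x y bounds P (suc x) (suc y) from above, floor P x y bounds P x y from
-- below, so that both involve the same two entries.
ceiling : Grid → ℕ → ℕ → ℕ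
ceiling P x y = P x (suc y) ⊓ P (suc x) y

floor : Grid → ℕ → ℕ → ℕ
floor P x y = P x (suc y) ⊔ P (suc x) y

⊓+⊔≡+ : ∀ m n → m ⊓ n + (m ⊔ n) ≡ m + n
⊓+⊔≡+ m n with ≤-total m n
... | inj₁ m≤n = cong₂ _+_ (m≤n⇒m⊓n≡m m≤n) (m≤n⇒m⊔n≡n m≤n)
... | inj₂ n≤m = trans (cong₂ _+_ (m≥n⇒m⊓n≡n n≤m) (m≥n⇒m⊔n≡m n≤m)) (+-comm n m)

-- Reflects the entry at (`suc x`, `suc y`) in the interval that its four neighbours allow. On a
-- boxed grid the truncated subtraction is exact, since the entry is at most the ceiling.
reflected : Grid → ℕ → ℕ → ℕ
reflected P x y = ceiling P x y + floor P (suc x) (suc y) ∸ P (suc x) (suc y)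

floor≤ : ∀ {b w h P} → Boxed b w h P → ∀ x y → floor P x y ≤ P x y
floor≤ B x y = ⊔-lub (row-anti B x y) (col-anti B x y)

≤ceiling : ∀ {b w h P} → Boxed b w h P → ∀ x y → P (suc x) (suc y) ≤ ceiling P x y
≤ceiling B x y = ⊓-glb (col-anti B x (suc y)) (row-anti B (suc x) y)

-- The cell (suc x , suc y) lies on the diagonal through (i , n), strictly beyond that cell.
Beyond : (i n x y : ℕ) → Set
Beyond i n x y = i ≤ x × x + n ≡ y + i

beyond? : ∀ i n x y → Dec (Beyond i n x y)
beyond? i n x y = (i ≤? x) ×-dec (x + n ≟ y + i)

-- All cells strictly beyond (`i`, `n`) on its diagonal move at once. The cell (`i`, `n`) itself
-- stays: as a last-passage time it already equals its weight plus its floor.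
toggle : ℕ → ℕ → Grid → Grid
toggle i n P zero    y       = P zero y
toggle i n P (suc x) zero    = P (suc x) zero
toggle i n P (suc x) (suc y) = if does (beyond? i n x y) then reflected P x y else P (suc x) (suc y)

module _ (i n : ℕ) (P : Grid) where

  toggle-on : ∀ x y → Beyond i n x y → toggle i n P (suc x) (suc y) ≡ reflected P x y
  toggle-on x y on = cong (if_then reflected P x y else P (suc x) (suc y)) (dec-true (beyond? i n x y) on)

  toggle-¬beyond : ∀ x y → ¬ Beyond i n x y → toggle i n P (suc x) (suc y) ≡ P (suc x) (suc y)
  toggle-¬beyond x y off = cong (if_then reflected P x y else P (suc x) (suc y)) (dec-false (beyond? i n x y) off)

  toggle-off : ∀ x y → ¬ (x + n ≡ y + i) → toggle i n P x y ≡ P x y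
  toggle-off zero    y       off = refl
  toggle-off (suc x) zero    off = refl
  toggle-off (suc x) (suc y) off = toggle-¬beyond x y (off ∘ cong suc ∘ proj₂)

  toggle-above : ∀ x y → x ≤ i → toggle i n P x y ≡ P x y
  toggle-above zero    y       x≤i = refl
  toggle-above (suc x) zero    x≤i = refl
  toggle-above (suc x) (suc y) x≤i = toggle-¬beyond x y λ (i≤x , _) → 1+n≰n (≤-trans x≤i i≤x)

  next-off : ∀ x y → x + n ≡ y + i → ¬ (x + n ≡ suc y + i)
  next-off x y on on′ = 1+n≢n (trans (sym on′) on)

  next-offʳ : ∀ x y → x + n ≡ y + i → ¬ (suc x + n ≡ y + i)
  next-offʳ x y on on′ = 1+n≢n (trans on′ (sym on))

  -- The neighbours of a cell on the toggled diagonal lie on the two adjacent diagonals, which do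
  -- not move. Hence the simultaneous reflections do not interact.
  ceiling-toggle : ∀ x y → x + n ≡ y + i → ceiling (toggle i n P) x y ≡ ceiling P x y
  ceiling-toggle x y on = cong₂ _⊓_ (toggle-off _ _ (next-off x y on)) (toggle-off _ _ (next-offʳ x y on))

  floor-toggle : ∀ x y → x + n ≡ y + i → floor (toggle i n P) x y ≡ floor P x y
  floor-toggle x y on = cong₂ _⊔_ (toggle-off _ _ (next-off x y on)) (toggle-off _ _ (next-offʳ x y on))

toggle-cong : ∀ i n {P Q} → P ≐ Q → toggle i n P ≐ toggle i n Q
toggle-cong i n P≐Q zero    y       = P≐Q zero y
toggle-cong i n P≐Q (suc x) zero    = P≐Q (suc x) zero
toggle-cong i n {P} {Q} P≐Q (suc x) (suc y) =
  cong₂ (if does (beyond? i n x y) then_else_)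
    (cong₂ _∸_
      (cong₂ _+_ (cong₂ _⊓_ (P≐Q _ _) (P≐Q _ _)) (cong₂ _⊔_ (P≐Q _ _) (P≐Q _ _)))
      (P≐Q _ _))
    (P≐Q _ _)

module _ {b w h P} (i n : ℕ) (B : Boxed b w h P) where

  entry≤ceiling+floor : ∀ x y → P (suc x) (suc y) ≤ ceiling P x y + floor P (suc x) (suc y)
  entry≤ceiling+floor x y = ≤-trans (≤ceiling B x y) (m≤m+n _ _)

  reflected≤ceiling : ∀ x y → reflected P x y ≤ ceiling P x y
  reflected≤ceiling x y = ≤-trans
    (∸-monoʳ-≤ (ceiling P x y + floor P (suc x) (suc y)) (floor≤ B (suc x) (suc y)))
    (≤-reflexive (m+n∸n≡m (ceiling P x y) (floor P (suc x) (suc y))))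

  floor≤reflected : ∀ x y → floor P (suc x) (suc y) ≤ reflected P x y
  floor≤reflected x y = ≤-trans
    (≤-reflexive (sym (m+n∸m≡n (ceiling P x y) (floor P (suc x) (suc y)))))
    (∸-monoʳ-≤ (ceiling P x y + floor P (suc x) (suc y)) (≤ceiling B x y))

  toggle≤ceiling : ∀ x y → toggle i n P (suc x) (suc y) ≤ ceiling P x y
  toggle≤ceiling x y with beyond? i n x y
  ... | yes on = ≤-trans (≤-reflexive (toggle-on i n P x y on)) (reflected≤ceiling x y)
  ... | no off = ≤-trans (≤-reflexive (toggle-¬beyond i n P x y off)) (≤ceiling B x y)

  floor≤toggle : ∀ x y → floor P x y ≤ toggle i n P x y
  floor≤toggle zero    y       = floor≤ B zero y
  floor≤toggle (suc x) zero    = floor≤ B (suc x) zero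
  floor≤toggle (suc x) (suc y) with beyond? i n x y
  ... | yes on = ≤-trans (floor≤reflected x y) (≤-reflexive (sym (toggle-on i n P x y on)))
  ... | no off = ≤-trans (floor≤ B (suc x) (suc y)) (≤-reflexive (sym (toggle-¬beyond i n P x y off)))

  -- Of two adjacent cells at most one moves. If it is the larger one, it stays above its old floor;
  -- if it is the smaller one, it stays below its old ceiling. The ceiling also keeps moved entries
  -- within the box.
  toggle-boxed : Boxed b w h (toggle i n P)
  toggle-boxed .row-anti x y with x + n ≟ y + i
  ... | yes on = ≤-trans (≤-reflexive (toggle-off i n P x (suc y) (next-off i n P x y on)))
                         (≤-trans (m≤m⊔n _ _) (floor≤toggle x y))
  ... | no off = ≤-trans (left x) (≤-reflexive (sym (toggle-off i n P x y off)))
    where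
    left : ∀ x → toggle i n P x (suc y) ≤ P x y
    left zero    = row-anti B zero y
    left (suc x) = ≤-trans (toggle≤ceiling x y) (m⊓n≤n _ _)
  toggle-boxed .col-anti x y with x + n ≟ y + i
  ... | yes on = ≤-trans (≤-reflexive (toggle-off i n P (suc x) y (next-offʳ i n P x y on)))
                         (≤-trans (m≤n⊔m _ _) (floor≤toggle x y))
  ... | no off = ≤-trans (up y) (≤-reflexive (sym (toggle-off i n P x y off)))
    where
    up : ∀ y → toggle i n P (suc x) y ≤ P x y
    up zero    = col-anti B x zero
    up (suc y) = ≤-trans (toggle≤ceiling x y) (m⊓n≤m _ _)
  toggle-boxed .below zero    y       b≤x = below B zero y b≤x
  toggle-boxed .below (suc x) zero    b≤x = below B (suc x) zero b≤x
  toggle-boxed .below (suc x) (suc y) b≤x = n≤0⇒n≡0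
    (≤-trans (toggle≤ceiling x y) (≤-trans (m⊓n≤n _ _) (≤-reflexive (below B (suc x) y b≤x))))
  toggle-boxed .right zero    y       w≤y = right B zero y w≤y
  toggle-boxed .right (suc x) zero    w≤y = right B (suc x) zero w≤y
  toggle-boxed .right (suc x) (suc y) w≤y = n≤0⇒n≡0
    (≤-trans (toggle≤ceiling x y) (≤-trans (m⊓n≤m _ _) (≤-reflexive (right B x (suc y) w≤y))))
  toggle-boxed .bound zero    y       = bound B zero y
  toggle-boxed .bound (suc x) zero    = bound B (suc x) zero
  toggle-boxed .bound (suc x) (suc y) =
    ≤-trans (toggle≤ceiling x y) (≤-trans (m⊓n≤m _ _) (bound B x (suc y)))

  -- The second reflection happens in the same interval as the first, because ceiling and floor are
  -- unchanged.
  toggle-involutive : toggle i n (toggle i n P) ≐ P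
  toggle-involutive zero    y       = refl
  toggle-involutive (suc x) zero    = refl
  toggle-involutive (suc x) (suc y) with beyond? i n x y
  ... | no off = trans (toggle-¬beyond i n (toggle i n P) x y off) (toggle-¬beyond i n P x y off)
  ... | yes on@(_ , eq) = begin
    toggle i n (toggle i n P) (suc x) (suc y)
      ≡⟨ toggle-on i n (toggle i n P) x y on ⟩
    reflected (toggle i n P) x y
      ≡⟨ cong₂ _∸_ (cong₂ _+_ (ceiling-toggle i n P x y eq)
                              (floor-toggle i n P (suc x) (suc y) (cong suc eq)))
                   (toggle-on i n P x y on) ⟩
    ceiling P x y + floor P (suc x) (suc y) ∸ reflected P x y
      ≡⟨ m∸[m∸n]≡n (entry≤ceiling+floor x y) ⟩
    P (suc x) (suc y) ∎
    where open ≡-Reasoning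

-- Composing toggles into the RSK correspondence.

-- The inverse laws are restricted to boxed grids, where the subtraction in a toggle is exact. Since
-- they hold only up to `≐`, composing them uses the congruence fields.
record Automorphism (b w h : ℕ) : Set where
  field
    to from    : Grid → Grid
    to-boxed   : ∀ {P} → Boxed b w h P → Boxed b w h (to P)
    from-boxed : ∀ {P} → Boxed b w h P → Boxed b w h (from P)
    to-cong    : ∀ {P Q} → P ≐ Q → to P ≐ to Q
    from-cong  : ∀ {P Q} → P ≐ Q → from P ≐ from Q
    to-from    : ∀ {P} → Boxed b w h P → to (from P) ≐ P
    from-to    : ∀ {P} → Boxed b w h P → from (to P) ≐ P

open Automorphism

module _ {b w h : ℕ} where

  identity : Automorphism b w h
  identity = record
    { to = id ; from = id ; to-boxed = id ; from-boxed = id ; to-cong = id ; from-cong = id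
    ; to-from = λ _ _ _ → refl ; from-to = λ _ _ _ → refl }

  infixr 9 _∙_
  _∙_ : Automorphism b w h → Automorphism b w h → Automorphism b w h
  F ∙ G = record
    { to         = to F ∘ to G
    ; from       = from G ∘ from F
    ; to-boxed   = to-boxed F ∘ to-boxed G
    ; from-boxed = from-boxed G ∘ from-boxed F
    ; to-cong    = to-cong F ∘ to-cong G
    ; from-cong  = from-cong G ∘ from-cong F
    ; to-from    = λ B x y → trans (to-cong F (to-from G (from-boxed F B)) x y) (to-from F B x y)
    ; from-to    = λ B x y → trans (from-cong G (from-to F (to-boxed G B)) x y) (from-to G B x y)
    }

  toggling : ℕ → ℕ → Automorphism b w h
  toggling i n = record
    { to         = toggle i n
    ; from       = toggle i n
    ; to-boxed   = toggle-boxed i n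
    ; from-boxed = toggle-boxed i n
    ; to-cong    = toggle-cong i n
    ; from-cong  = toggle-cong i n
    ; to-from    = toggle-involutive i n
    ; from-to    = toggle-involutive i n
    }

  -- `_∙_` applies its right factor first, so the columns of row `i` are visited from `n ∸ 1` down
  -- to 0.
  rowInsertion : ℕ → ℕ → Automorphism b w h
  rowInsertion i zero    = identity
  rowInsertion i (suc n) = rowInsertion i n ∙ toggling i n

  -- Rows are visited from the last to the first. When (`i`, `n`) is reached, the diagonals to its
  -- right, below it and beyond it are those of a growth diagram already built from the far corner.
  rsk : ℕ → Automorphism b w h
  rsk zero    = identity
  rsk (suc i) = rsk i ∙ rowInsertion i w

-- Weights, diagonal sums and their change under RSK.

-- The matrix whose last-passage times (from (x , y) to the far corner) are the entries of P.
weight : Grid → ℕ → ℕ → ℕ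
weight P x y = P x y ∸ floor P x y

weight+floor : ∀ {b w h P} → Boxed b w h P → ∀ x y → weight P x y + floor P x y ≡ P x y
weight+floor B x y = m∸n+n≡m (floor≤ B x y)

diagonal : ℕ → Grid → ℕ → ℕ → ℕ
diagonal zero    P x y = 0
diagonal (suc k) P x y = P x y + diagonal k P (suc x) (suc y)

-- The additional cell lies in row `x + k`, at or below row `b`, where the grid vanishes.
diagonal-suc : ∀ {b w h P} → Boxed b w h P → ∀ k x y → b ≤ x + k → diagonal (suc k) P x y ≡ diagonal k P x y
diagonal-suc {b = b} B zero    x y b≤x = trans (+-identityʳ _) (below B x y (subst (b ≤_) (+-identityʳ x) b≤x))
diagonal-suc {b = b} {P = P} B (suc k) x y b≤x = cong (P x y +_) (diagonal-suc B k (suc x) (suc y) (subst (b ≤_) (+-suc x k) b≤x))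

diagonal-off : ∀ i n P k x y → ¬ (x + n ≡ y + i) → diagonal k (toggle i n P) x y ≡ diagonal k P x y
diagonal-off i n P zero    x y off = refl
diagonal-off i n P (suc k) x y off =
  cong₂ _+_ (toggle-off i n P x y off) (diagonal-off i n P k (suc x) (suc y) (off ∘ suc-injective))

-- Telescoping: ceiling P x y + floor P x y is the sum of the two neighbours.
diagonal-on : ∀ {b w h P} → Boxed b w h P → ∀ i n k x y → Beyond i n x y →
  diagonal k (toggle i n P) (suc x) (suc y) + diagonal k P (suc x) (suc y) + floor P x y
    ≡ diagonal k P x (suc y) + diagonal k P (suc x) y + floor P (x + k) (y + k)
diagonal-on {P = P} B i n zero x y on = cong₂ (floor P) (sym (+-identityʳ x)) (sym (+-identityʳ y))
diagonal-on {P = P} B i n (suc k) x y on@(i≤x , eq) = begin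
  (toggle i n P (suc x) (suc y) + D′) + (P (suc x) (suc y) + D) + floor P x y
    ≡⟨ cong (λ t → (t + D′) + (P (suc x) (suc y) + D) + floor P x y) (toggle-on i n P x y on) ⟩
  (reflected P x y + D′) + (P (suc x) (suc y) + D) + floor P x y
    ≡⟨ shuffle₁ (reflected P x y) D′ (P (suc x) (suc y)) D (floor P x y) ⟩
  (reflected P x y + P (suc x) (suc y)) + (D′ + D + floor P x y)
    ≡⟨ cong (_+ (D′ + D + floor P x y)) (m∸n+n≡m (entry≤ceiling+floor i n B x y)) ⟩
  (ceiling P x y + floor P (suc x) (suc y)) + (D′ + D + floor P x y)
    ≡⟨ shuffle₂ (ceiling P x y) (floor P (suc x) (suc y)) D′ D (floor P x y) ⟩
  (ceiling P x y + floor P x y) + (D′ + D + floor P (suc x) (suc y))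
    ≡⟨ cong₂ _+_ (⊓+⊔≡+ (P x (suc y)) (P (suc x) y))
         (diagonal-on B i n k (suc x) (suc y) (m≤n⇒m≤1+n i≤x , cong suc eq)) ⟩
  (P x (suc y) + P (suc x) y) + (E + F + floor P (suc x + k) (suc y + k))
    ≡⟨ shuffle₃ (P x (suc y)) (P (suc x) y) E F (floor P (suc x + k) (suc y + k)) ⟩
  (P x (suc y) + E) + (P (suc x) y + F) + floor P (suc x + k) (suc y + k)
    ≡⟨ cong₂ (λ s t → (P x (suc y) + E) + (P (suc x) y + F) + floor P s t)
         (sym (+-suc x k)) (sym (+-suc y k)) ⟩
  (P x (suc y) + E) + (P (suc x) y + F) + floor P (x + suc k) (y + suc k) ∎
  where
  open ≡-Reasoning
  D′ = diagonal k (toggle i n P) (suc (suc x)) (suc (suc y))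
  D  = diagonal k P (suc (suc x)) (suc (suc y))
  E  = diagonal k P (suc x) (suc (suc y))
  F  = diagonal k P (suc (suc x)) (suc y)
  shuffle₁ : ∀ r d′ p d f → (r + d′) + (p + d) + f ≡ (r + p) + (d′ + d + f)
  shuffle₁ = solve-∀
  shuffle₂ : ∀ c f′ d′ d f → (c + f′) + (d′ + d + f) ≡ (c + f) + (d′ + d + f′)
  shuffle₂ = solve-∀
  shuffle₃ : ∀ p q e f g → (p + q) + (e + f + g) ≡ (p + e) + (q + f) + g
  shuffle₃ = solve-∀

module _ {b w h : ℕ} where

  floor-below : ∀ {P} → Boxed b w h P → ∀ x y → b ≤ x → floor P x y ≡ 0
  floor-below B x y b≤x = cong₂ _⊔_ (below B x (suc y) b≤x) (below B (suc x) y (m≤n⇒m≤1+n b≤x))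

  -- The growth rule of RSK at the level of sizes: the new shape and the opposite corner together
  -- weigh as much as the two intermediate shapes plus the matrix entry. It is `diagonal-on` from
  -- the head of the diagonal, where the last floor vanishes.
  diagonal-toggle : ∀ {P} → Boxed b w h P → ∀ i n →
    diagonal b (toggle i n P) i n + diagonal b P (suc i) (suc n)
      ≡ weight P i n + (diagonal b P i (suc n) + diagonal b P (suc i) n)
  diagonal-toggle {P} B i n = +-cancelʳ-≡ (floor P i n) _ _ (begin
    diagonal b P′ i n + D + f
      -- Lengthening the diagonal by a zero cell lets the head at (`i`, `n`) split off and leaves a
      -- tail of length `b`.
      ≡⟨ cong (λ t → t + D + f) (sym (diagonal-suc (toggle-boxed i n B) b i n (m≤n+m b i))) ⟩
    P′ i n + D′ + D + f
      ≡⟨ cong (λ t → t + D′ + D + f) (toggle-above i n P i n ≤-refl) ⟩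
    P i n + D′ + D + f
      ≡⟨ trans (+-assoc (P i n + D′) D f) (trans (+-assoc (P i n) D′ (D + f)) (cong (P i n +_) (sym (+-assoc D′ D f)))) ⟩
    P i n + (D′ + D + f)
      ≡⟨ cong₂ _+_ (sym (weight+floor B i n)) (diagonal-on B i n b i n (≤-refl , +-comm i n)) ⟩
    (weight P i n + f) + (E + F + floor P (i + b) (n + b))
      ≡⟨ cong (λ t → (weight P i n + f) + (E + F + t)) (floor-below B (i + b) (n + b) (m≤n+m b i)) ⟩
    (weight P i n + f) + (E + F + 0)
      ≡⟨ shuffle (weight P i n) f E F ⟩
    weight P i n + (E + F) + f ∎)
    where
    open ≡-Reasoning
    P′ = toggle i n P
    f  = floor P i n
    D′ = diagonal b P′ (suc i) (suc n)
    D  = diagonal b P (suc i) (suc n)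
    E  = diagonal b P i (suc n)
    F  = diagonal b P (suc i) n
    shuffle : ∀ v f e g → (v + f) + (e + g + 0) ≡ v + (e + g) + f
    shuffle = solve-∀

  rowInsertion-above : ∀ {P} i n x y → x ≤ i → to (rowInsertion {b} {w} {h} i n) P x y ≡ P x y
  rowInsertion-above i zero    x y x≤i = refl
  rowInsertion-above {P} i (suc n) x y x≤i =
    trans (rowInsertion-above i n x y x≤i) (toggle-above i n P x y x≤i)

  weight-cong : ∀ {P Q} x y → P x y ≡ Q x y → P x (suc y) ≡ Q x (suc y) → P (suc x) y ≡ Q (suc x) y →
    weight P x y ≡ weight Q x y
  weight-cong x y e₁ e₂ e₃ = cong₂ _∸_ e₁ (cong₂ _⊔_ e₂ e₃)

  -- Before the toggle at n, the diagonals from row i are already processed at and to the right of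
  -- column n + 1, and those from row i + 1 are still untouched to the left of it.
  rowInsertion-diagonal : ∀ {P} → Boxed b w h P → ∀ i n (u v : ℕ → ℕ) →
    (∀ y → n ≤ y → y < w → diagonal b P i y ≡ v y + u y + diagonal b P i (suc y)) →
    (∀ y → y < n → diagonal b P (suc i) y ≡ u y + diagonal b P (suc i) (suc y)) →
    (∀ y → y < n → weight P i y ≡ v y) →
    let Q = to (rowInsertion {b} {w} {h} i n) P in
    ∀ y → y < w → diagonal b Q i y ≡ v y + u y + diagonal b Q i (suc y)
  rowInsertion-diagonal B i zero    u v done todo v-def y y<w = done y z≤n y<w
  rowInsertion-diagonal {P} B i (suc n) u v done todo v-def =
    rowInsertion-diagonal (toggle-boxed i n B) i n u v done′ todo′ v-def′
    where
    open ≡-Reasoning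
    P′ = toggle i n P

    i+n≢ : ∀ {y} → n < y → ¬ (i + n ≡ y + i)
    i+n≢ n<y e = <-irrefl (+-cancelʳ-≡ i _ _ (trans (+-comm n i) e)) n<y

    si+n≢ : ∀ {y} → y ≤ n → ¬ (suc i + n ≡ y + i)
    si+n≢ {y} y≤n e = <-irrefl (sym (+-cancelʳ-≡ i _ _ (trans (cong suc (+-comm n i)) e))) (s≤s y≤n)

    done′ : ∀ y → n ≤ y → y < w → diagonal b P′ i y ≡ v y + u y + diagonal b P′ i (suc y)
    done′ y n≤y y<w with m≤n⇒m<n∨m≡n n≤y
    ... | inj₁ n<y = trans (diagonal-off i n P b i y (i+n≢ n<y))
            (trans (done y n<y y<w)
              (cong (v y + u y +_) (sym (diagonal-off i n P b i (suc y) (i+n≢ (m≤n⇒m≤1+n n<y))))))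
    ... | inj₂ refl = +-cancelʳ-≡ (diagonal b P (suc i) (suc n)) _ _ (begin
      diagonal b P′ i n + D
        ≡⟨ diagonal-toggle B i n ⟩
      weight P i n + (E + diagonal b P (suc i) n)
        ≡⟨ cong₂ (λ s t → s + (E + t)) (v-def n ≤-refl) (todo n ≤-refl) ⟩
      v n + (E + (u n + D))
        ≡⟨ shuffle (v n) E (u n) D ⟩
      v n + u n + E + D
        ≡⟨ cong (λ t → v n + u n + t + D) (sym (diagonal-off i n P b i (suc n) (i+n≢ ≤-refl))) ⟩
      v n + u n + diagonal b P′ i (suc n) + D ∎)
      where
      D = diagonal b P (suc i) (suc n)
      E = diagonal b P i (suc n)
      shuffle : ∀ p q r s → p + (q + (r + s)) ≡ p + r + q + s
      shuffle = solve-∀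

    todo′ : ∀ y → y < n → diagonal b P′ (suc i) y ≡ u y + diagonal b P′ (suc i) (suc y)
    todo′ y y<n = trans (diagonal-off i n P b (suc i) y (si+n≢ (<⇒≤ y<n)))
      (trans (todo y (m≤n⇒m≤1+n y<n))
        (cong (u y +_) (sym (diagonal-off i n P b (suc i) (suc y) (si+n≢ y<n)))))

    v-def′ : ∀ y → y < n → weight P′ i y ≡ v y
    v-def′ y y<n = trans
      (weight-cong {P′} {P} i y (toggle-above i n P i y ≤-refl) (toggle-above i n P i (suc y) ≤-refl)
        (toggle-off i n P (suc i) y (si+n≢ (<⇒≤ y<n))))
      (v-def y (m≤n⇒m≤1+n y<n))

  -- Here `u` accumulates the column sums of the weights of the rows from `i` on, which are already
  -- inserted. Each further insertion moves the weights of one row from the sum into `u`.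
  rsk-diagonal-from : ∀ {P} → Boxed b w h P → ∀ i (u : ℕ → ℕ) →
    (∀ y → y < w → diagonal b P i y ≡ u y + diagonal b P i (suc y)) →
    let Q = to (rsk {b} {w} {h} i) P in
    ∀ y → y < w → diagonal b Q 0 y ≡ ∑ i (λ x → weight P x y) + u y + diagonal b Q 0 (suc y)
  rsk-diagonal-from B zero u diag y y<w = diag y y<w
  rsk-diagonal-from {P} B (suc i) u diag y y<w = begin
    diagonal b Q 0 y
      ≡⟨ rsk-diagonal-from (to-boxed (rowInsertion i w) B) i _ step y y<w ⟩
    ∑ i (λ x → weight R x y) + (weight P i y + u y) + diagonal b Q 0 (suc y)
      -- Inserting row `i` fixes the rows up to `i`, and a weight in row `x < i` reads only rows `x`
      -- and `suc x`.
      ≡⟨ cong (λ t → t + (weight P i y + u y) + diagonal b Q 0 (suc y))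
           (∑-cong i λ x x<i → weight-cong {R} {P} x y (above x y (<⇒≤ x<i)) (above x (suc y) (<⇒≤ x<i)) (above (suc x) y x<i)) ⟩
    ∑ i (λ x → weight P x y) + (weight P i y + u y) + diagonal b Q 0 (suc y)
      ≡⟨ cong (_+ diagonal b Q 0 (suc y)) (sym (+-assoc (∑ i (λ x → weight P x y)) (weight P i y) (u y))) ⟩
    ∑ i (λ x → weight P x y) + weight P i y + u y + diagonal b Q 0 (suc y)
      ≡⟨ cong (λ t → t + u y + diagonal b Q 0 (suc y)) (sym (∑-last i (λ x → weight P x y))) ⟩
    ∑ (suc i) (λ x → weight P x y) + u y + diagonal b Q 0 (suc y) ∎
    where
    open ≡-Reasoning
    R = to (rowInsertion {b} {w} {h} i w) P
    Q = to (rsk {b} {w} {h} i) R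
    above : ∀ x y → x ≤ i → R x y ≡ P x y
    above = rowInsertion-above i w
    step : ∀ y → y < w → diagonal b R i y ≡ (weight P i y + u y) + diagonal b R i (suc y)
    -- At `n = w` no column of row `i` is processed yet, so the first invariant is vacuous.
    step = rowInsertion-diagonal B i w u (weight P i)
      (λ y w≤y y<w → ⊥-elim (<-irrefl refl (≤-trans y<w w≤y))) diag (λ y y<w → refl)

  diagonal-below : ∀ {P} → Boxed b w h P → ∀ k x y → b ≤ x → diagonal k P x y ≡ 0
  diagonal-below B zero    x y b≤x = refl
  diagonal-below B (suc k) x y b≤x = cong₂ _+_ (below B x y b≤x) (diagonal-below B k (suc x) (suc y) (m≤n⇒m≤1+n b≤x))

  -- The induction starts at row `b`, where every diagonal sum vanishes and `u` is zero.
  rsk-diagonal : ∀ {P} → Boxed b w h P → let Q = to (rsk {b} {w} {h} b) P in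
    ∀ y → y < w → diagonal b Q 0 y ≡ ∑ b (λ x → weight P x y) + diagonal b Q 0 (suc y)
  rsk-diagonal {P} B y y<w = trans
    (rsk-diagonal-from B b (λ _ → 0)
      (λ y _ → trans (diagonal-below B b b y ≤-refl) (sym (diagonal-below B b b (suc y) ≤-refl))) y y<w)
    (cong (_+ diagonal b (to (rsk {b} {w} {h} b) P) 0 (suc y)) (+-identityʳ (∑ b (λ x → weight P x y))))

-- Indicators and further rules for sums.

𝟙 : {A : Set} → Dec A → ℕ
𝟙 a? = if does a? then 1 else 0

𝟙-yes : {A : Set} (a? : Dec A) → A → 𝟙 a? ≡ 1
𝟙-yes a? a = cong (if_then 1 else 0) (dec-true a? a)

𝟙-no : {A : Set} (a? : Dec A) → ¬ A → 𝟙 a? ≡ 0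
𝟙-no a? ¬a = cong (if_then 1 else 0) (dec-false a? ¬a)

𝟙-cong : {A B : Set} → A ⇔ B → (a? : Dec A) (b? : Dec B) → 𝟙 a? ≡ 𝟙 b?
𝟙-cong A⇔B a? b? = cong (if_then 1 else 0) (does-⇔ A⇔B a? b?)

𝟙≤1 : {A : Set} (a? : Dec A) → 𝟙 a? ≤ 1
𝟙≤1 (yes _) = ≤-refl
𝟙≤1 (no _)  = z≤n

𝟙-mono : {A B : Set} → (A → B) → (a? : Dec A) (b? : Dec B) → 𝟙 a? ≤ 𝟙 b?
𝟙-mono f (yes a) b? = ≤-reflexive (sym (𝟙-yes b? (f a)))
𝟙-mono f (no _)  b? = z≤n

∑-zero : ∀ n {f : ℕ → ℕ} → (∀ i → i < n → f i ≡ 0) → ∑ n f ≡ 0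
∑-zero zero    f≡0 = refl
∑-zero (suc n) f≡0 = cong₂ _+_ (f≡0 0 (s≤s z≤n)) (∑-zero n λ i i<n → f≡0 (suc i) (s≤s i<n))

∑-+ : ∀ n (f g : ℕ → ℕ) → ∑ n (λ i → f i + g i) ≡ ∑ n f + ∑ n g
∑-+ zero    f g = refl
∑-+ (suc n) f g = trans (cong (f 0 + g 0 +_) (∑-+ n (f ∘ suc) (g ∘ suc)))
  (interchange (f 0) (g 0) (∑ n (f ∘ suc)) (∑ n (g ∘ suc)))
  where
  interchange : ∀ p q r s → p + q + (r + s) ≡ p + r + (q + s)
  interchange = solve-∀

∑-swap : ∀ m n (f : ℕ → ℕ → ℕ) → ∑ m (λ i → ∑ n (f i)) ≡ ∑ n (λ j → ∑ m (λ i → f i j))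
∑-swap zero    n f = sym (∑-zero n λ _ _ → refl)
∑-swap (suc m) n f = trans (cong (∑ n (f 0) +_) (∑-swap m n (f ∘ suc)))
  (sym (∑-+ n (f 0) (λ j → ∑ m (λ i → f (suc i) j))))

∑-mono : ∀ n {f g : ℕ → ℕ} → (∀ i → f i ≤ g i) → ∑ n f ≤ ∑ n g
∑-mono zero    f≤g = z≤n
∑-mono (suc n) f≤g = +-mono-≤ (f≤g 0) (∑-mono n (f≤g ∘ suc))

∑-𝟙≤ : ∀ n {P : ℕ → Set} (P? : ∀ i → Dec (P i)) → ∑ n (λ i → 𝟙 (P? i)) ≤ n
∑-𝟙≤ zero    P? = z≤n
∑-𝟙≤ (suc n) P? = +-mono-≤ (𝟙≤1 (P? 0)) (∑-𝟙≤ n (P? ∘ suc))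

∑-reverse : ∀ n (f : ℕ → ℕ) → ∑ n (λ i → f (n ∸ suc i)) ≡ ∑ n f
∑-reverse zero    f = refl
∑-reverse (suc n) f = trans (cong (f n +_) (∑-reverse n f)) (trans (+-comm (f n) _) (sym (∑-last n f)))

-- Conjugation of partitions

Antitone : (ℕ → ℕ) → Set
Antitone f = ∀ i → f (suc i) ≤ f i

antitone-≤ : ∀ {f} → Antitone f → ∀ {i j} → i ≤ j → f j ≤ f i
antitone-≤ {f} anti {j = zero}  z≤n = ≤-refl
antitone-≤ {f} anti {i} {suc j} i≤j with m≤n⇒m<n∨m≡n i≤j
... | inj₁ i<j  = ≤-trans (anti j) (antitone-≤ anti (s≤s⁻¹ i<j))
... | inj₂ refl = ≤-refl

conjugate : ℕ → (ℕ → ℕ) → ℕ → ℕ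
conjugate w f k = ∑ w (λ j → 𝟙 (k <? f j))

-- For antitone `f` the indices counted by `conjugate` form an initial segment, and the size of such
-- a segment exceeds `j` exactly when it contains `j`.
<conjugate : ∀ w {f} → Antitone f → ∀ j k → j < conjugate w f k ⇔ (j < w × k < f j)
<conjugate zero anti j k = mk⇔ (λ ()) (λ ())
<conjugate (suc w) {f} anti j k with k <? f 0
... | no k≮f0 = mk⇔
  (λ j<c → ⊥-elim (n≮0 (subst (j <_) (∑-zero (suc w) λ i _ → 𝟙-no (k <? f i) (none i)) j<c)))
  (λ (_ , k<fj) → ⊥-elim (none j k<fj))
  where
  none : ∀ i → ¬ (k < f i)
  none i k<fi = k≮f0 (≤-trans k<fi (antitone-≤ anti z≤n))
... | yes k<f0 = subst (λ t → j < t + conjugate w (f ∘ suc) k ⇔ (j < suc w × k < f j))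
  (sym (𝟙-yes (k <? f 0) k<f0)) (mk⇔ (fwd j) (bwd j))
  where
  IH : ∀ j → j < conjugate w (f ∘ suc) k ⇔ (j < w × k < f (suc j))
  IH j = <conjugate w (anti ∘ suc) j k
  fwd : ∀ j → j < suc (conjugate w (f ∘ suc) k) → j < suc w × k < f j
  fwd zero    _   = s≤s z≤n , k<f0
  fwd (suc j) j<c = let j<w , k<f = ⇒ (IH j) (s≤s⁻¹ j<c) in s≤s j<w , k<f
  bwd : ∀ j → j < suc w × k < f j → j < suc (conjugate w (f ∘ suc) k)
  bwd zero    _           = s≤s z≤n
  bwd (suc j) (j<w , k<f) = s≤s (⇐ (IH j) (s≤s⁻¹ j<w , k<f))

conj : ℕ → Grid → Grid
conj w P x = conjugate w (P x)

conj-cong : ∀ w {P Q} → P ≐ Q → conj w P ≐ conj w Q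
conj-cong w P≐Q x k = ∑-cong w λ j _ → cong (λ t → 𝟙 (k <? t)) (P≐Q x j)

<-ext : ∀ {m n} → (∀ k → k < m ⇔ k < n) → m ≡ n
<-ext {m} {n} k<m⇔k<n = ≤-antisym
  (≮⇒≥ λ n<m → <-irrefl refl (⇒ (k<m⇔k<n n) n<m))
  (≮⇒≥ λ m<n → <-irrefl refl (⇐ (k<m⇔k<n m) m<n))

module _ {b w h P} (B : Boxed b w h P) where

  conj-boxed : Boxed b h w (conj w P)
  conj-boxed .row-anti x k = ∑-mono w λ j → 𝟙-mono <⇒≤ (suc k <? P x j) (k <? P x j)
  conj-boxed .col-anti x k = ∑-mono w λ j →
    𝟙-mono (λ k<p → ≤-trans k<p (col-anti B x j)) (k <? P (suc x) j) (k <? P x j)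
  conj-boxed .below x k b≤x = ∑-zero w λ j _ →
    𝟙-no (k <? P x j) λ k<p → n≮0 (subst (k <_) (below B x j b≤x) k<p)
  conj-boxed .right x k h≤k = ∑-zero w λ j _ →
    𝟙-no (k <? P x j) λ k<p → <-irrefl refl (≤-trans k<p (≤-trans (bound B x j) h≤k))
  conj-boxed .bound x k = ∑-𝟙≤ w λ j → k <? P x j

  -- The condition `j < w` is absorbed: `k < P x j` forces it, as columns from `w` on are zero.
  <conj : ∀ x j k → j < conj w P x k ⇔ k < P x j
  <conj x j k = mk⇔ (proj₂ ∘ ⇒ galois) (λ k<p → ⇐ galois (≰⇒> (λ w≤j → n≮0 (subst (k <_) (right B x j w≤j) k<p)) , k<p))
    where galois = <conjugate w (row-anti B x) j k

-- The equivalence `<conj` exchanges the roles of `j` and `k`; using it twice determines each entry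
-- by the numbers below it.
conj-involutive : ∀ {b w h P} → Boxed b w h P → conj h (conj w P) ≐ P
conj-involutive B x j = <-ext λ k → mk⇔
  (⇒ (<conj B x j k) ∘ ⇒ (<conj (conj-boxed B) x k j))
  (⇐ (<conj (conj-boxed B) x k j) ∘ ⇐ (<conj B x j k))

conjugate-suc : ∀ w f k → conjugate w f k ≡ ∑ w (λ j → 𝟙 (f j ≟ suc k)) + conjugate w f (suc k)
conjugate-suc w f k = trans (∑-cong w λ j _ → split (f j)) (∑-+ w _ _)
  where
  split : ∀ p → 𝟙 (k <? p) ≡ 𝟙 (p ≟ suc k) + 𝟙 (suc k <? p)
  split p with <-cmp p (suc k)
  ... | tri< p<sk p≢sk _ = trans (𝟙-no (k <? p) λ k<p → <-irrefl refl (≤-trans p<sk k<p))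
          (sym (cong₂ _+_ (𝟙-no (p ≟ suc k) p≢sk) (𝟙-no (suc k <? p) λ sk<p → <-irrefl refl (<-trans p<sk sk<p))))
  ... | tri≈ _ refl _ = trans (𝟙-yes (k <? p) ≤-refl)
          (sym (cong₂ _+_ (𝟙-yes (p ≟ suc k) refl) (𝟙-no (suc k <? p) (<-irrefl refl))))
  ... | tri> _ p≢sk sk<p = trans (𝟙-yes (k <? p) (<⇒≤ sk<p))
          (sym (cong₂ _+_ (𝟙-no (p ≟ suc k) p≢sk) (𝟙-yes (suc k <? p) sk<p)))

-- Each step down the diagonal raises row and threshold together, so the difference of consecutive
-- diagonals counts the entries `suc (k + i)` in row `x + i`. This shift by the row index is the one
-- that separates plane partitions from tableaux.
diagonal-conj : ∀ w P b x k →
  diagonal b (conj w P) x k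
    ≡ ∑ b (λ i → ∑ w (λ j → 𝟙 (P (x + i) j ≟ suc (k + i)))) + diagonal b (conj w P) x (suc k)
diagonal-conj w P zero    x k = refl
diagonal-conj w P (suc b) x k = begin
  conj w P x k + diagonal b (conj w P) (suc x) (suc k)
    ≡⟨ cong₂ _+_ (conjugate-suc w (P x) k) (diagonal-conj w P b (suc x) (suc k)) ⟩
  (N x k + conj w P x (suc k)) + (∑ b (λ i → N (suc x + i) (suc k + i)) + D)
    ≡⟨ interchange (N x k) (conj w P x (suc k)) _ D ⟩
  (N x k + ∑ b (λ i → N (suc x + i) (suc k + i))) + (conj w P x (suc k) + D)
    ≡⟨ cong (_+ (conj w P x (suc k) + D)) (cong₂ _+_
         (cong₂ N (sym (+-identityʳ x)) (sym (+-identityʳ k)))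
         (∑-cong b λ i _ → cong₂ N (sym (+-suc x i)) (sym (+-suc k i)))) ⟩
  ∑ (suc b) (λ i → N (x + i) (k + i)) + (conj w P x (suc k) + D) ∎
  where
  open ≡-Reasoning
  N : ℕ → ℕ → ℕ
  N x k = ∑ w (λ j → 𝟙 (P x j ≟ suc k))
  D = diagonal b (conj w P) (suc x) (suc (suc k))
  interchange : ∀ p q r s → p + q + (r + s) ≡ p + r + (q + s)
  interchange = solve-∀

-- The last occurrence of suc k in a column with consecutive entries p, q.
lastEntry? : ∀ k p q → Dec (p ≡ suc k × ¬ (k < q))
lastEntry? k p q = (p ≟ suc k) ×-dec ¬? (k <? q)

∑-𝟙-< : ∀ n m → m ≤ n → ∑ n (λ j → 𝟙 (j <? m)) ≡ m
∑-𝟙-< zero    zero    m≤n = refl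
∑-𝟙-< (suc n) zero    m≤n = ∑-zero (suc n) λ j _ → 𝟙-no (j <? 0) n≮0
∑-𝟙-< (suc n) (suc m) m≤n = cong suc (trans
  (∑-cong n λ j _ → 𝟙-cong (mk⇔ s≤s⁻¹ s≤s) (suc j <? suc m) (j <? m)) (∑-𝟙-< n m (s≤s⁻¹ m≤n)))

-- The columns `j` with `k < P x j` split in two: those with `suc k < P x j` or `k < P (suc x) j`,
-- which are exactly the `j` below the floor, and those where `suc k` occurs for the last time in
-- row `x`.
weight-conj : ∀ {b w h P} → Boxed b w h P → ∀ x k →
  weight (conj w P) x k ≡ ∑ w (λ j → 𝟙 (lastEntry? k (P x j) (P (suc x) j)))
weight-conj {b} {w} {h} {P} B x k = begin
  C x k ∸ floor C x k
    ≡⟨ cong (_∸ floor C x k) (sym split) ⟩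
  L + floor C x k ∸ floor C x k
    ≡⟨ m+n∸n≡m L (floor C x k) ⟩
  L ∎
  where
  open ≡-Reasoning
  C = conj w P
  L = ∑ w (λ j → 𝟙 (lastEntry? k (P x j) (P (suc x) j)))
  <floor : ∀ j → j < floor C x k ⇔ (suc k < P x j ⊎ k < P (suc x) j)
  <floor j = mk⇔ fwd bwd
    where
    fwd : j < floor C x k → suc k < P x j ⊎ k < P (suc x) j
    fwd j<f with ⊔-sel (C x (suc k)) (C (suc x) k)
    ... | inj₁ e = inj₁ (⇒ (<conj B x j (suc k)) (subst (j <_) e j<f))
    ... | inj₂ e = inj₂ (⇒ (<conj B (suc x) j k) (subst (j <_) e j<f))
    bwd : suc k < P x j ⊎ k < P (suc x) j → j < floor C x k
    bwd (inj₁ sk<p) = ≤-trans (⇐ (<conj B x j (suc k)) sk<p) (m≤m⊔n _ _)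
    bwd (inj₂ k<q)  = ≤-trans (⇐ (<conj B (suc x) j k) k<q) (m≤n⊔m _ _)
  pointwise : ∀ j →
    𝟙 (lastEntry? k (P x j) (P (suc x) j)) + 𝟙 (j <? floor C x k) ≡ 𝟙 (k <? P x j)
  pointwise j with j <? floor C x k
  ... | yes j<f = trans
      (cong₂ _+_ (𝟙-no (lastEntry? k (P x j) (P (suc x) j)) (notLast (⇒ (<floor j) j<f)))
             (𝟙-yes (j <? floor C x k) j<f))
      (sym (𝟙-yes (k <? P x j) (k<p (⇒ (<floor j) j<f))))
    where
    notLast : suc k < P x j ⊎ k < P (suc x) j → ¬ (P x j ≡ suc k × ¬ (k < P (suc x) j))
    notLast (inj₁ sk<p) (p≡sk , _) = <-irrefl (sym p≡sk) sk<p
    notLast (inj₂ k<q)  (_ , k≮q)  = k≮q k<q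
    k<p : suc k < P x j ⊎ k < P (suc x) j → k < P x j
    k<p (inj₁ sk<p) = <⇒≤ sk<p
    k<p (inj₂ k<q)  = ≤-trans k<q (col-anti B x j)
  ... | no j≮f = trans
      (trans (cong (𝟙 (lastEntry? k (P x j) (P (suc x) j)) +_) (𝟙-no (j <? floor C x k) j≮f)) (+-identityʳ _))
      (𝟙-cong
      (mk⇔ (λ (p≡sk , _) → ≤-reflexive (sym p≡sk))
           (λ k<p → ≤-antisym (≮⇒≥ (j≮f ∘ ⇐ (<floor j) ∘ inj₁)) k<p , j≮f ∘ ⇐ (<floor j) ∘ inj₂))
      (lastEntry? k (P x j) (P (suc x) j)) (k <? P x j))
  split : L + floor C x k ≡ C x k
  split = begin
    L + floor C x k
      -- The floor is rewritten as a count of indices below `w`, which is legitimate because it is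
      -- at most `w`; then both sides compare column by column.
      ≡⟨ cong (L +_) (sym (∑-𝟙-< w (floor C x k)
           (≤-trans (floor≤ (conj-boxed B) x k) (bound (conj-boxed B) x k)))) ⟩
    L + ∑ w (λ j → 𝟙 (j <? floor C x k))
      ≡⟨ sym (∑-+ w _ _) ⟩
    ∑ w (λ j → 𝟙 (lastEntry? k (P x j) (P (suc x) j)) + 𝟙 (j <? floor C x k))
      ≡⟨ ∑-cong w (λ j _ → pointwise j) ⟩
    C x k ∎

-- Equal entries of a weakly decreasing column are consecutive, so a value that occurs has exactly
-- one last occurrence; `f b ≤ k` makes it fall before `b`. The decision `d` is arbitrary so that
-- the induction can change it.
𝟙-occurs : ∀ b {f} → Antitone f → ∀ k → f b ≤ k → (d : Dec (∃ λ i → i < b × f i ≡ suc k)) →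
  𝟙 d ≡ ∑ b (λ i → 𝟙 (lastEntry? k (f i) (f (suc i))))
𝟙-occurs zero anti k fb≤k d = 𝟙-no d λ ()
𝟙-occurs (suc b) {f} anti k fb≤k d with lastEntry? k (f 0) (f 1)
-- All later entries are at most `f 1`, hence at most `k`, and contribute nothing.
... | yes (f0≡sk , k≮f1) = trans (𝟙-yes d (0 , s≤s z≤n , f0≡sk))
  (sym (cong₂ _+_ (𝟙-yes (lastEntry? k (f 0) (f 1)) (f0≡sk , k≮f1))
    (∑-zero b λ i _ → 𝟙-no (lastEntry? k (f (suc i)) (f (suc (suc i))))
      λ (e , _) → k≮f1 (≤-trans (≤-reflexive (sym e)) (antitone-≤ (anti ∘ suc) (z≤n {i}))))))
... | no ¬last = trans (𝟙-cong (mk⇔ shift λ (i , i<b , e) → suc i , s≤s i<b , e) d d′)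
                       (trans (𝟙-occurs b (anti ∘ suc) k fb≤k d′)
                              (cong (_+ ∑ b (λ i → 𝟙 (lastEntry? k (f (suc i)) (f (suc (suc i))))))
                                    (sym (𝟙-no (lastEntry? k (f 0) (f 1)) ¬last))))
  where
  d′ : Dec (∃ λ i → i < b × f (suc i) ≡ suc k)
  d′ = anyUpTo? (λ i → f (suc i) ≟ suc k) b
  shift : (∃ λ i → i < suc b × f i ≡ suc k) → ∃ λ i → i < b × f (suc i) ≡ suc k
  shift (suc i , i<b , e) = i , s≤s⁻¹ i<b , e
  shift (zero  , _   , e) with k <? f 1
  ... | no k≮f1  = ⊥-elim (¬last (e , k≮f1))
  -- Since `k < f 1` and `f 1 ≤ f 0 = suc k`, the value recurs at index 1; this index is in range
  -- because `f (suc b) ≤ k`.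
  ... | yes k<f1 = 0 , ≰⇒> (λ b≤0 → <-irrefl refl (≤-trans k<f1 (≤-trans (antitone-≤ anti (s≤s b≤0)) fb≤k)))
                     , ≤-antisym (≤-trans (anti 0) (≤-reflexive e)) k<f1

-- Enumerations up to an equivalence

-- Arrays are functions and are compared pointwise, so absence of repetitions and membership refer
-- to the equivalence of `S`.
record Enumerates (S : Setoid 0ℓ 0ℓ) (G : Setoid.Carrier S → Set) (xs : List (Setoid.Carrier S)) : Set where
  open Membership S using (_∈_)
  field
    unique   : Unique.Unique S xs
    sound    : All G xs
    complete : ∀ {x} → G x → x ∈ xs

open Enumerates

module _ (S : Setoid 0ℓ 0ℓ) where
  open Setoid S using (_≈_) renaming (sym to ≈-sym)

  lookup-injective : ∀ {xs} → Unique.Unique S xs → ∀ i j → lookup xs i ≈ lookup xs j → i ≡ j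
  lookup-injective (x∉xs ∷ xs!) zero    zero    x≈y = refl
  lookup-injective (x∉xs ∷ xs!) zero    (suc j) x≈y = ⊥-elim (All.lookup x∉xs (∈-lookup j) x≈y)
  lookup-injective (x∉xs ∷ xs!) (suc i) zero    x≈y = ⊥-elim (All.lookup x∉xs (∈-lookup i) (≈-sym x≈y))
  lookup-injective (x∉xs ∷ xs!) (suc i) (suc j) x≈y = cong suc (lookup-injective xs! i j x≈y)

  filter-enumerates : ∀ {G xs} {P : Setoid.Carrier S → Set} (P? : Decidable P) → P Respects _≈_ →
    Enumerates S G xs → Enumerates S (λ x → G x × P x) (filter P? xs)
  filter-enumerates {xs = xs} P? resp E = record
    { unique   = Uniqueₚ.filter⁺ S P? (unique E)
    ; sound    = All.zip (All.filter⁺ P? (sound E) , All.all-filter P? xs)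
    ; complete = λ (g , p) → Membershipₚ.∈-filter⁺ S P? resp (complete E g) p
    }

module _ (S T : Setoid 0ℓ 0ℓ) where
  open Setoid S using () renaming (Carrier to X; _≈_ to _≈₁_; sym to sym₁; trans to trans₁)
  open Setoid T using () renaming (Carrier to Y; _≈_ to _≈₂_)

  -- Sends a position in `xs` to the position of the image in `ys`. Equal positions make the images
  -- equivalent, and applying `g` brings this back to the original elements.
  length≤ : ∀ {G H xs ys} → Enumerates S G xs → Enumerates T H ys →
    (f : X → Y) (g : Y → X) →
    (∀ {x} → G x → H (f x)) → (∀ {x y} → x ≈₂ y → g x ≈₁ g y) → (∀ {x} → G x → g (f x) ≈₁ x) →
    length xs ≤ length ys
  length≤ {xs = xs} E F f g f-maps g-cong g∘f =
    injective⇒≤ {f = λ i → index (f∈ i)} λ {i} {j} eq → lookup-injective S (unique E) i j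
      (trans₁ (sym₁ (g∘f (Gx i)))
        (trans₁ (g-cong (Membershipₚ.index-injective T (f∈ i) (f∈ j) eq)) (g∘f (Gx j))))
    where
    Gx = λ i → All.lookup (sound E) (∈-lookup {xs = xs} i)
    f∈ = λ i → complete F (f-maps (Gx i))

-- As a cartesian product, the enumeration has its uniqueness and membership decided componentwise.
allFuns-cartesian : ∀ {A : Set} n (xs : List A) →
  allFuns (suc n) xs ≡ cartesianProductWith (λ f x → x Vector.∷ f) (allFuns n xs) xs
allFuns-cartesian {A} n xs = go (allFuns n xs)
  where
  go : (fs : List (Fin n → A)) →
    concatMap (λ f → map (λ x → x Vector.∷ f) xs) fs ≡ cartesianProductWith (λ f x → x Vector.∷ f) fs xs
  go []       = refl
  go (f ∷ fs) = cong (map (λ x → x Vector.∷ f) xs Data.List.++_) (go fs)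

module _ (S : Setoid 0ℓ 0ℓ) where

  allFuns-enumerates : ∀ n {xs} → Enumerates S (λ _ → ⊤) xs →
    Enumerates (≋-setoid S n) (λ _ → ⊤) (allFuns n xs)
  allFuns-enumerates zero    E = record
    { unique = [] ∷ [] ; sound = tt ∷ [] ; complete = λ _ → here λ () }
  allFuns-enumerates (suc n) {xs} E = subst (Enumerates (≋-setoid S (suc n)) (λ _ → ⊤))
    (sym (allFuns-cartesian n xs)) record
    { unique   = Uniqueₚ.cartesianProductWith⁺ (≋-setoid S n) S (≋-setoid S (suc n)) _
                   (λ eq → (λ i → eq (suc i)) , eq zero) (unique IH) (unique E)
    ; sound    = All.universal (λ _ → tt) _
    ; complete = λ {f} _ → Membershipₚ.∈-resp-≈ (≋-setoid S (suc n)) (λ { zero → Setoid.refl S ; (suc i) → Setoid.refl S })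
                   (Membershipₚ.∈-cartesianProductWith⁺ (≋-setoid S n) S (≋-setoid S (suc n))
                     (λ { eq e zero → e ; eq e (suc i) → eq i })
                     (complete IH {λ i → f (suc i)} tt) (complete E {f zero} tt))
    }
    where IH = allFuns-enumerates n E

arrays : (r s m : ℕ) → Setoid 0ℓ 0ℓ
arrays r s m = ≋-setoid (≋-setoid (setoid (Fin m)) s) r

infix 4 _≈_
_≈_ : ∀ {r s m} → Array r s m → Array r s m → Set
_≈_ {r} {s} {m} = Setoid._≈_ (arrays r s m)

allArrays-enumerates : ∀ r s m → Enumerates (arrays r s m) (λ _ → ⊤) (allArrays r s m)
allArrays-enumerates r s m =
  allFuns-enumerates (≋-setoid (setoid (Fin m)) s) r (allFuns-enumerates (setoid (Fin m)) s record
    { unique   = Uniqueₚ.tabulate⁺ (setoid (Fin m)) id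
    ; sound    = All.universal (λ _ → tt) _
    ; complete = λ {i} _ → ∈-allFin i
    })

-- Plane partitions as grids

extend : ∀ {n} → (Fin n → ℕ) → ℕ → ℕ
extend {zero}  f x       = 0
extend {suc n} f zero    = f zero
extend {suc n} f (suc x) = extend (f ∘ suc) x

extend-toℕ : ∀ {n} (f : Fin n → ℕ) i → extend f (toℕ i) ≡ f i
extend-toℕ f zero    = refl
extend-toℕ f (suc i) = extend-toℕ (f ∘ suc) i

extend-beyond : ∀ {n} (f : Fin n → ℕ) {x} → n ≤ x → extend f x ≡ 0
extend-beyond {zero}  f n≤x       = refl
extend-beyond {suc n} f (s≤s n≤x) = extend-beyond (f ∘ suc) n≤x

extend-mono : ∀ {n} {f g : Fin n → ℕ} → (∀ i → f i ≤ g i) → ∀ x → extend f x ≤ extend g x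
extend-mono {zero}  f≤g x       = z≤n
extend-mono {suc n} f≤g zero    = f≤g zero
extend-mono {suc n} f≤g (suc x) = extend-mono (f≤g ∘ suc) x

extend-≤ : ∀ {n h} {f : Fin n → ℕ} → (∀ i → f i ≤ h) → ∀ x → extend f x ≤ h
extend-≤ {zero}  f≤h x       = z≤n
extend-≤ {suc n} f≤h zero    = f≤h zero
extend-≤ {suc n} f≤h (suc x) = extend-≤ (f≤h ∘ suc) x

extend-antitone : ∀ {n} {f : Fin n → ℕ} → (∀ i j → i ≤ᶠ j → f j ≤ f i) → Antitone (extend f)
extend-antitone {zero}        anti x       = z≤n
extend-antitone {suc zero}    anti zero    = z≤n
extend-antitone {suc (suc n)} anti zero    = anti zero (suc zero) z≤n
extend-antitone {suc n}       anti (suc x) = extend-antitone (λ i j i≤j → anti (suc i) (suc j) (s≤s i≤j)) x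

extend-cong : ∀ {n} {f g : Fin n → ℕ} → (∀ i → f i ≡ g i) → ∀ x → extend f x ≡ extend g x
extend-cong {zero}  f≡g x       = refl
extend-cong {suc n} f≡g zero    = f≡g zero
extend-cong {suc n} f≡g (suc x) = extend-cong (f≡g ∘ suc) x

extend-restrict : ∀ n {f : ℕ → ℕ} → (∀ x → n ≤ x → f x ≡ 0) → ∀ x → extend {n} (f ∘ toℕ) x ≡ f x
extend-restrict zero    f≡0 x       = sym (f≡0 x z≤n)
extend-restrict (suc n) f≡0 zero    = refl
extend-restrict (suc n) f≡0 (suc x) = extend-restrict n (λ y n≤y → f≡0 (suc y) (s≤s n≤y)) x

grid : ∀ {b a m} → Array b a m → Grid
grid π x y = extend (λ i → extend (λ j → toℕ (π i j)) y) x

grid-toℕ : ∀ {b a m} (π : Array b a m) i j → grid π (toℕ i) (toℕ j) ≡ toℕ (π i j)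
grid-toℕ π i j = trans (extend-toℕ _ i) (extend-toℕ _ j)

grid-cong : ∀ {b a m} {π ρ : Array b a m} → π ≈ ρ → grid π ≐ grid ρ
grid-cong π≈ρ x y = extend-cong (λ i → extend-cong (λ j → cong toℕ (π≈ρ i j)) y) x

grid-boxed : ∀ {b a c} {π : Array b a (suc c)} → IsPlanePartition π → Boxed b a c (grid π)
grid-boxed (row , col) .row-anti x y = extend-mono (λ i → extend-antitone (row i) y) x
grid-boxed (row , col) .col-anti x y = extend-antitone (λ i i′ i≤i′ → extend-mono (λ j → col i i′ j i≤i′) y) x
grid-boxed {π = π} (row , col) .below x y b≤x = extend-beyond (λ i → extend (λ j → toℕ (π i j)) y) b≤x
grid-boxed {π = π} (row , col) .right x y a≤y =
  n≤0⇒n≡0 (extend-≤ (λ i → ≤-reflexive (extend-beyond (λ j → toℕ (π i j)) a≤y)) x)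
grid-boxed {π = π} (row , col) .bound x y =
  extend-≤ (λ i → extend-≤ (λ j → s≤s⁻¹ (toℕ<n (π i j))) y) x

-- Makes `array` and `untableau` total; on entries at most `c` nothing is cut off.
clamp : ∀ c → ℕ → Fin (suc c)
clamp c n = fromℕ< (s≤s (m⊓n≤n n c))

toℕ-clamp : ∀ c n → toℕ (clamp c n) ≡ n ⊓ c
toℕ-clamp c n = toℕ-fromℕ< (s≤s (m⊓n≤n n c))

clamp-toℕ : ∀ {c} (k : Fin (suc c)) → clamp c (toℕ k) ≡ k
clamp-toℕ {c} k = toℕ-injective (trans (toℕ-clamp c (toℕ k)) (m≤n⇒m⊓n≡m (s≤s⁻¹ (toℕ<n k))))

clamp-mono : ∀ c {m n} → m ≤ n → clamp c m ≤ᶠ clamp c n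
clamp-mono c m≤n = subst₂ _≤_ (sym (toℕ-clamp c _)) (sym (toℕ-clamp c _)) (⊓-monoˡ-≤ c m≤n)

array : ∀ {b a c} → Grid → Array b a (suc c)
array {c = c} P i j = clamp c (P (toℕ i) (toℕ j))

array-cong : ∀ {b a c P Q} → P ≐ Q → array {b} {a} {c} P ≈ array Q
array-cong {c = c} P≐Q i j = cong (clamp c) (P≐Q (toℕ i) (toℕ j))

array-planePartition : ∀ {b a c P} → Boxed b a c P → IsPlanePartition (array {b} {a} {c} P)
array-planePartition {c = c} B =
  (λ i j j′ j≤j′ → clamp-mono c (antitone-≤ (row-anti B (toℕ i)) j≤j′)) ,
  (λ i i′ j i≤i′ → clamp-mono c (antitone-≤ (λ x → col-anti B x (toℕ j)) i≤i′))

array-grid : ∀ {b a c} (π : Array b a (suc c)) → array (grid π) ≈ π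
array-grid {c = c} π i j = trans (cong (clamp c) (grid-toℕ π i j)) (clamp-toℕ (π i j))

grid-array : ∀ {b a c P} → Boxed b a c P → grid (array {b} {a} {c} P) ≐ P
grid-array {b} {a} {c} {P} B x y = trans
  (extend-cong {b} (λ i → trans
    (extend-cong {a} (λ j → trans (toℕ-clamp c _) (m≤n⇒m⊓n≡m (bound B (toℕ i) (toℕ j)))) y)
    (extend-restrict a (right B (toℕ i)) y)) x)
  (extend-restrict b (λ x → below B x y) x)

-- Plane partitions and rectangular tableaux

opposite-antitone : ∀ {n} {i j : Fin n} → i ≤ᶠ j → opposite j ≤ᶠ opposite i
opposite-antitone {n} {i} {j} i≤j =
  subst₂ _≤_ (sym (opposite-prop j)) (sym (opposite-prop i)) (∸-monoʳ-≤ n (s≤s i≤j))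

module _ {b a c : ℕ} where

  -- The half turn makes rows and columns weakly increasing, and adding the row index makes columns
  -- strict. Letters are counted from zero.
  tableau : Array b a (suc c) → Array b a (b + c)
  tableau π i j = fromℕ< (+-mono-<-≤ (toℕ<n i) (s≤s⁻¹ (toℕ<n (π (opposite i) (opposite j)))))

  -- The row index subtracted is the one in `T`, hence `opposite i`. For a semistandard `T`,
  -- `strict-lower` and `strict-upper` show that neither the subtraction nor the clamp truncates.
  untableau : Array b a (b + c) → Array b a (suc c)
  untableau T i j = clamp c (toℕ (T (opposite i) (opposite j)) ∸ toℕ (opposite i))

  toℕ-tableau : ∀ π i j → toℕ (tableau π i j) ≡ toℕ i + toℕ (π (opposite i) (opposite j))
  toℕ-tableau π i j = toℕ-fromℕ< _

  tableau-cong : ∀ {π ρ} → π ≈ ρ → tableau π ≈ tableau ρ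
  tableau-cong {π} {ρ} π≈ρ i j = toℕ-injective (trans (toℕ-tableau π i j)
    (trans (cong (λ k → toℕ i + toℕ k) (π≈ρ (opposite i) (opposite j))) (sym (toℕ-tableau ρ i j))))

  untableau-cong : ∀ {T U} → T ≈ U → untableau T ≈ untableau U
  untableau-cong T≈U i j = cong (λ k → clamp c (toℕ k ∸ toℕ (opposite i))) (T≈U (opposite i) (opposite j))

  tableau-SSYT : ∀ {π} → IsPlanePartition π → IsSSYT (tableau π)
  tableau-SSYT {π} (row , col) =
    (λ i j j′ j≤j′ → subst₂ _≤_ (sym (toℕ-tableau π i j)) (sym (toℕ-tableau π i j′))
      (+-monoʳ-≤ (toℕ i) (row (opposite i) _ _ (opposite-antitone j≤j′)))) ,
    (λ i i′ j i<i′ → subst₂ _<_ (sym (toℕ-tableau π i j)) (sym (toℕ-tableau π i′ j))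
      (+-mono-<-≤ i<i′ (col _ _ (opposite j) (opposite-antitone (<⇒≤ i<i′)))))

-- A subtraction-free form of the fact that `f i - i` is weakly increasing when `f` is strictly
-- increasing.
strict-spread : ∀ {n} {f : Fin n → ℕ} → (∀ i j → i <ᶠ j → f i < f j) →
  ∀ i j → i ≤ᶠ j → toℕ j + f i ≤ toℕ i + f j
strict-spread                 f-strict zero    zero    _ = ≤-refl
strict-spread {suc (suc n)} {f} f-strict zero  (suc j) _ = ≤-trans
  (subst (_≤ toℕ j + f (suc zero)) (+-suc (toℕ j) (f zero))
    (+-monoʳ-≤ (toℕ j) (f-strict zero (suc zero) (s≤s z≤n))))
  (strict-spread (λ i j i<j → f-strict (suc i) (suc j) (s≤s i<j)) zero j z≤n)
strict-spread f-strict (suc i) (suc j) i≤j =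
  s≤s (strict-spread (λ i j i<j → f-strict (suc i) (suc j) (s≤s i<j)) i j (s≤s⁻¹ i≤j))

strict-lower : ∀ {n} {f : Fin n → ℕ} → (∀ i j → i <ᶠ j → f i < f j) → ∀ i → toℕ i ≤ f i
strict-lower {suc n} f-strict i = m+n≤o⇒m≤o (toℕ i) (strict-spread f-strict zero i z≤n)

-- Compares `i` with the last index; among `suc n` values the last one is at most `n + c`.
strict-upper : ∀ {n c} {f : Fin n → ℕ} → (∀ i j → i <ᶠ j → f i < f j) → (∀ i → f i < n + c) →
  ∀ i → f i ∸ toℕ i ≤ c
strict-upper {suc n} {c} {f} f-strict f< i = m≤n+o⇒m∸n≤o (f i) (toℕ i) (+-cancelˡ-≤ n _ _ (begin
  n + f i                     ≡⟨ cong (_+ f i) (sym (toℕ-fromℕ n)) ⟩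
  toℕ (fromℕ n) + f i         ≤⟨ strict-spread f-strict i (fromℕ n) i≤n ⟩
  toℕ i + f (fromℕ n)         ≤⟨ +-monoʳ-≤ (toℕ i) (s≤s⁻¹ (f< (fromℕ n))) ⟩
  toℕ i + (n + c)             ≡⟨ trans (sym (+-assoc (toℕ i) n c)) (trans (cong (_+ c) (+-comm (toℕ i) n)) (+-assoc n (toℕ i) c)) ⟩
  n + (toℕ i + c)             ∎))
  where
  open ≤-Reasoning
  i≤n : toℕ i ≤ toℕ (fromℕ n)
  i≤n = ≤-trans (s≤s⁻¹ (toℕ<n i)) (≤-reflexive (sym (toℕ-fromℕ n)))

module _ {b a c : ℕ} where

  untableau-planePartition : {T : Array b a (b + c)} → IsSSYT T → IsPlanePartition (untableau {b} {a} {c} T)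
  untableau-planePartition {T} (row , col) =
    (λ i j j′ j≤j′ → clamp-mono c (∸-monoˡ-≤ (toℕ (opposite i)) (row (opposite i) _ _ (opposite-antitone j≤j′)))) ,
    (λ i i′ j i≤i′ → clamp-mono c (rows (opposite j) (opposite-antitone i≤i′)))
    where
    rows : ∀ j {p q} → p ≤ᶠ q → toℕ (T p j) ∸ toℕ p ≤ toℕ (T q j) ∸ toℕ q
    rows j {p} {q} p≤q = m≤n+o⇒m∸n≤o (toℕ (T p j)) (toℕ p) (+-cancelˡ-≤ (toℕ q) _ _ (begin
      toℕ q + toℕ (T p j)
        ≤⟨ strict-spread {f = λ i → toℕ (T i j)} (λ i i′ → col i i′ j) p q p≤q ⟩
      toℕ p + toℕ (T q j)
        ≡⟨ cong (toℕ p +_) (sym (m+[n∸m]≡n (strict-lower {f = λ i → toℕ (T i j)} (λ i i′ → col i i′ j) q))) ⟩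
      toℕ p + (toℕ q + (toℕ (T q j) ∸ toℕ q))
        ≡⟨ trans (sym (+-assoc (toℕ p) (toℕ q) _)) (trans (cong (_+ (toℕ (T q j) ∸ toℕ q)) (+-comm (toℕ p) (toℕ q))) (+-assoc (toℕ q) (toℕ p) _)) ⟩
      toℕ q + (toℕ p + (toℕ (T q j) ∸ toℕ q)) ∎))
      where open ≤-Reasoning

  untableau-tableau : (π : Array b a (suc c)) → untableau (tableau π) ≈ π
  untableau-tableau π i j = begin
    clamp c (toℕ (tableau π (opposite i) (opposite j)) ∸ toℕ (opposite i))
      ≡⟨ cong (λ k → clamp c (k ∸ toℕ (opposite i))) (toℕ-tableau π (opposite i) (opposite j)) ⟩
    clamp c (toℕ (opposite i) + toℕ (π (opposite (opposite i)) (opposite (opposite j))) ∸ toℕ (opposite i))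
      ≡⟨ cong (clamp c) (m+n∸m≡n (toℕ (opposite i)) _) ⟩
    clamp c (toℕ (π (opposite (opposite i)) (opposite (opposite j))))
      ≡⟨ clamp-toℕ _ ⟩
    π (opposite (opposite i)) (opposite (opposite j))
      ≡⟨ cong₂ π (opposite-involutive i) (opposite-involutive j) ⟩
    π i j ∎
    where open ≡-Reasoning

  tableau-untableau : {T : Array b a (b + c)} → IsSSYT T → tableau (untableau {b} {a} {c} T) ≈ T
  tableau-untableau {T} (row , col) i j = toℕ-injective (begin
    toℕ (tableau (untableau T) i j)
      ≡⟨ toℕ-tableau (untableau T) i j ⟩
    toℕ i + toℕ (clamp c (toℕ (T (opposite (opposite i)) (opposite (opposite j))) ∸ toℕ (opposite (opposite i))))
      ≡⟨ cong₂ (λ p q → toℕ i + toℕ (clamp c (toℕ (T p q) ∸ toℕ p))) (opposite-involutive i) (opposite-involutive j) ⟩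
    toℕ i + toℕ (clamp c (toℕ (T i j) ∸ toℕ i))
      ≡⟨ cong (toℕ i +_) (trans (toℕ-clamp c _) (m≤n⇒m⊓n≡m (strict-upper {f = λ i → toℕ (T i j)} strict (λ i → toℕ<n (T i j)) i))) ⟩
    toℕ i + (toℕ (T i j) ∸ toℕ i)
      ≡⟨ m+[n∸m]≡n (strict-lower {f = λ i → toℕ (T i j)} strict i) ⟩
    toℕ (T i j) ∎)
    where
    open ≡-Reasoning
    strict = λ i i′ → col i i′ j

-- The statistics in terms of grids

module _ {A : Set} {P : A → Set} (P? : Decidable P) where

  count-∷ : ∀ x xs → count P? (x ∷ xs) ≡ 𝟙 (P? x) + count P? xs
  count-∷ x xs with does (P? x)
  ... | true  = refl
  ... | false = refl

  count-tabulate : ∀ {n} (f : Fin n → A) {Q : ℕ → Set} (Q? : ∀ k → Dec (Q k)) →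
    (∀ i → P (f i) ⇔ Q (toℕ i)) → count P? (tabulate f) ≡ ∑ n (λ k → 𝟙 (Q? k))
  count-tabulate {zero}  f Q? P⇔Q = refl
  count-tabulate {suc n} f Q? P⇔Q = trans (count-∷ (f zero) (tabulate (f ∘ suc)))
    (cong₂ _+_ (𝟙-cong (P⇔Q zero) (P? (f zero)) (Q? 0))
               (count-tabulate (f ∘ suc) (Q? ∘ suc) (P⇔Q ∘ suc)))

sum-tabulate : ∀ {A : Set} {n} (g : A → ℕ) (f : Fin n → A) {h : ℕ → ℕ} →
  (∀ i → g (f i) ≡ h (toℕ i)) → sum (map g (tabulate f)) ≡ ∑ n h
sum-tabulate {n = zero}  g f eq = refl
sum-tabulate {n = suc n} g f eq = cong₂ _+_ (eq zero) (sum-tabulate g (f ∘ suc) (eq ∘ suc))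

module _ {b a c : ℕ} where

  -- Every column containing the entry is counted once, at its last occurrence. Exchanging the two
  -- sums groups these occurrences by row, where they are weights of the conjugated grid.
  Γ-weight : {π : Array b a (suc c)} → IsPlanePartition π → ∀ ℓ →
    Γ π ℓ ≡ ∑ b (λ x → weight (conj a (grid π)) x (toℕ ℓ))
  Γ-weight {π} pp ℓ = begin
    Γ π ℓ
      ≡⟨ count-tabulate _ id occurs? (λ j → mk⇔ (fwd j) (bwd j)) ⟩
    ∑ a (λ y → 𝟙 (occurs? y))
      ≡⟨ ∑-cong a (λ y _ → 𝟙-occurs b (λ x → col-anti B x y) (toℕ ℓ)
           (≤-trans (≤-reflexive (below B b y ≤-refl)) z≤n) (occurs? y)) ⟩
    ∑ a (λ y → ∑ b (λ x → 𝟙 (lastEntry? (toℕ ℓ) (P x y) (P (suc x) y))))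
      ≡⟨ ∑-swap a b _ ⟩
    ∑ b (λ x → ∑ a (λ y → 𝟙 (lastEntry? (toℕ ℓ) (P x y) (P (suc x) y))))
      ≡⟨ ∑-cong b (λ x _ → sym (weight-conj B x (toℕ ℓ))) ⟩
    ∑ b (λ x → weight (conj a P) x (toℕ ℓ)) ∎
    where
    open ≡-Reasoning
    P = grid π
    B = grid-boxed pp
    occurs? : ∀ y → Dec (∃ λ x → x < b × P x y ≡ suc (toℕ ℓ))
    occurs? y = anyUpTo? (λ x → P x y ≟ suc (toℕ ℓ)) b
    fwd : ∀ j → (∃ λ i → π i j ≡ suc ℓ) → ∃ λ x → x < b × P x (toℕ j) ≡ suc (toℕ ℓ)
    fwd j (i , e) = toℕ i , toℕ<n i , trans (grid-toℕ π i j) (cong toℕ e)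
    bwd : ∀ j → (∃ λ x → x < b × P x (toℕ j) ≡ suc (toℕ ℓ)) → ∃ λ i → π i j ≡ suc ℓ
    bwd j (x , x<b , e) = fromℕ< x<b , toℕ-injective (trans (sym (grid-toℕ π (fromℕ< x<b) j))
      (trans (cong (λ t → P t (toℕ j)) (toℕ-fromℕ< x<b)) e))

  -- Tableau row `i` comes from partition row `x = b - 1 - i`, so the letter `b + ℓ` corresponds to
  -- the entry `b + ℓ - i = ℓ + 1 + x`. Reversing both sums undoes the half turn.
  content-tableau : (π : Array b a (suc c)) (ℓ : Fin c) →
    content (tableau π) (b ↑ʳ ℓ) ≡ ∑ b (λ x → ∑ a (λ y → 𝟙 (grid π x y ≟ suc (toℕ ℓ + x))))
  content-tableau π ℓ = begin
    content (tableau π) (b ↑ʳ ℓ)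
      ≡⟨ sum-tabulate _ id (λ i → count-tabulate _ id
           (λ y → hit? (b ∸ suc (toℕ i)) (a ∸ suc y)) (λ j → letter i j)) ⟩
    ∑ b (λ x → ∑ a (λ y → 𝟙 (hit? (b ∸ suc x) (a ∸ suc y))))
      ≡⟨ ∑-reverse b (λ x → ∑ a (λ y → 𝟙 (hit? x (a ∸ suc y)))) ⟩
    ∑ b (λ x → ∑ a (λ y → 𝟙 (hit? x (a ∸ suc y))))
      ≡⟨ ∑-cong b (λ x _ → ∑-reverse a (λ y → 𝟙 (hit? x y))) ⟩
    ∑ b (λ x → ∑ a (λ y → 𝟙 (hit? x y))) ∎
    where
    open ≡-Reasoning
    hit? : ∀ x y → Dec (grid π x y ≡ suc (toℕ ℓ + x))
    hit? x y = grid π x y ≟ suc (toℕ ℓ + x)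

    entry : ∀ i j → toℕ (tableau π i j) ≡ toℕ i + grid π (b ∸ suc (toℕ i)) (a ∸ suc (toℕ j))
    entry i j = trans (toℕ-tableau π i j) (cong (toℕ i +_) (trans
      (sym (grid-toℕ π (opposite i) (opposite j)))
      (cong₂ (grid π) (opposite-prop i) (opposite-prop j))))

    target : ∀ (i : Fin b) → toℕ (b ↑ʳ ℓ) ≡ toℕ i + suc (toℕ ℓ + (b ∸ suc (toℕ i)))
    target i = begin
      toℕ (b ↑ʳ ℓ)                          ≡⟨ toℕ-↑ʳ b ℓ ⟩
      b + toℕ ℓ                             ≡⟨ cong (_+ toℕ ℓ) (sym (m+[n∸m]≡n (toℕ<n i))) ⟩
      suc (toℕ i) + (b ∸ suc (toℕ i)) + toℕ ℓ ≡⟨ shuffle (toℕ i) (b ∸ suc (toℕ i)) (toℕ ℓ) ⟩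
      toℕ i + suc (toℕ ℓ + (b ∸ suc (toℕ i))) ∎
      where
      shuffle : ∀ p q r → suc p + q + r ≡ p + suc (r + q)
      shuffle p q r = trans (cong suc (trans (+-assoc p q r) (cong (p +_) (+-comm q r)))) (sym (+-suc p (r + q)))

    letter : ∀ i j → tableau π i j ≡ b ↑ʳ ℓ ⇔
      grid π (b ∸ suc (toℕ i)) (a ∸ suc (toℕ j)) ≡ suc (toℕ ℓ + (b ∸ suc (toℕ i)))
    letter i j = mk⇔
      (λ e → +-cancelˡ-≡ (toℕ i) _ _ (trans (sym (entry i j)) (trans (cong toℕ e) (target i))))
      (λ e → toℕ-injective (trans (entry i j) (trans (cong (toℕ i +_) e) (sym (target i)))))

-- The bijection between plane partitions and tableaux, and the counts.

diagonal-cong : ∀ k {P Q} → P ≐ Q → ∀ x y → diagonal k P x y ≡ diagonal k Q x y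
diagonal-cong zero    P≐Q x y = refl
diagonal-cong (suc k) P≐Q x y = cong₂ _+_ (P≐Q x y) (diagonal-cong k P≐Q (suc x) (suc y))

module _ {b a c : ℕ} where

  through : (Grid → Grid) → Array b a (suc c) → Array b a (suc c)
  through F π = array (conj c (F (conj a (grid π))))

  -- Conjugating the rows exchanges width and height: the grids acted on have `c` columns and
  -- entries at most `a`.
  RSK : Automorphism b c a
  RSK = rsk b

  through-cong : ∀ {F} → (∀ {P Q} → P ≐ Q → F P ≐ F Q) → ∀ {π ρ} → π ≈ ρ → through F π ≈ through F ρ
  through-cong F-cong π≈ρ = array-cong (conj-cong c (F-cong (conj-cong a (grid-cong π≈ρ))))

  module _ {F : Grid → Grid} (F-boxed : ∀ {P} → Boxed b c a P → Boxed b c a (F P))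
           {π : Array b a (suc c)} (pp : IsPlanePartition π) where

    image-boxed : Boxed b c a (F (conj a (grid π)))
    image-boxed = F-boxed (conj-boxed (grid-boxed pp))

    through-planePartition : IsPlanePartition (through F π)
    through-planePartition = array-planePartition (conj-boxed image-boxed)

    -- As the image is boxed, passing to an array clamps nothing, and the two conjugations cancel.
    conj-grid-through : conj a (grid (through F π)) ≐ F (conj a (grid π))
    conj-grid-through x y = trans (conj-cong a (grid-array (conj-boxed image-boxed)) x y)
                                  (conj-involutive image-boxed x y)

    through-inverse : ∀ {G} → (∀ {P Q} → P ≐ Q → G P ≐ G Q) →
      (∀ {P} → Boxed b c a P → G (F P) ≐ P) → through G (through F π) ≈ π
    through-inverse G-cong G∘F i j = trans
      (array-cong (conj-cong c λ x y → trans (G-cong conj-grid-through x y) (G∘F (conj-boxed (grid-boxed pp)) x y)) i j)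
      (trans (array-cong (conj-involutive (grid-boxed pp)) i j) (array-grid π i j))

  toTableau : Array b a (suc c) → Array b a (b + c)
  toTableau = tableau ∘ through (to RSK)

  fromTableau : Array b a (b + c) → Array b a (suc c)
  fromTableau = through (from RSK) ∘ untableau

  -- Both statistics are the difference of the diagonal sums of `Q` from columns `k` and `suc k`:
  -- the content by `diagonal-conj`, and `Γ` by `rsk-diagonal` with `Γ-weight`.
  content-toTableau : {π : Array b a (suc c)} → IsPlanePartition π → ∀ ℓ →
    content (toTableau π) (b ↑ʳ ℓ) ≡ Γ π ℓ
  content-toTableau {π} pp ℓ = +-cancelʳ-≡ (diagonal b Q 0 (suc k)) _ _ (begin
    content (tableau ρ) (b ↑ʳ ℓ) + diagonal b Q 0 (suc k)
      ≡⟨ cong₂ _+_ (content-tableau ρ ℓ) (sym (diagonal-cong b (conj-grid-through (to-boxed RSK) pp) 0 (suc k))) ⟩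
    ∑ b (λ x → ∑ a (λ y → 𝟙 (grid ρ x y ≟ suc (k + x)))) + diagonal b (conj a (grid ρ)) 0 (suc k)
      ≡⟨ sym (diagonal-conj a (grid ρ) b 0 k) ⟩
    diagonal b (conj a (grid ρ)) 0 k
      ≡⟨ diagonal-cong b (conj-grid-through (to-boxed RSK) pp) 0 k ⟩
    diagonal b Q 0 k
      ≡⟨ rsk-diagonal (conj-boxed (grid-boxed pp)) k (toℕ<n ℓ) ⟩
    ∑ b (λ x → weight (conj a (grid π)) x k) + diagonal b Q 0 (suc k)
      ≡⟨ cong (_+ diagonal b Q 0 (suc k)) (sym (Γ-weight pp ℓ)) ⟩
    Γ π ℓ + diagonal b Q 0 (suc k) ∎)
    where
    open ≡-Reasoning
    k = toℕ ℓ
    ρ = through (to RSK) π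
    Q = to RSK (conj a (grid π))

  content-cong : {T U : Array b a (b + c)} → T ≈ U → ∀ k → content T k ≡ content U k
  content-cong T≈U k = cong sum (map-cong (λ i → cong length (filter-≐ (λ j → _ Fin.≟ k) (λ j → _ Fin.≟ k)
    ((λ {j} e → trans (sym (T≈U i j)) e) , (λ {j} e → trans (T≈U i j) e)) (allFin a))) (allFin b))

  Γ-cong : {π ρ : Array b a (suc c)} → π ≈ ρ → ∀ ℓ → Γ π ℓ ≡ Γ ρ ℓ
  Γ-cong {π} {ρ} π≈ρ ℓ = cong length (filter-≐ (λ j → any? λ i → π i j Fin.≟ suc ℓ) (λ j → any? λ i → ρ i j Fin.≟ suc ℓ)
    ((λ {j} (i , e) → i , trans (sym (π≈ρ i j)) e) , (λ {j} (i , e) → i , trans (π≈ρ i j) e)) (allFin a))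

  planePartitions-enumerates :
    Enumerates (arrays b a (suc c)) (λ π → ⊤ × IsPlanePartition π) (planePartitions a b c)
  planePartitions-enumerates = filter-enumerates _ isPlanePartition?
    (λ π≈ρ (row , col) →
      (λ i j j′ j≤j′ → subst₂ _≤ᶠ_ (π≈ρ i j′) (π≈ρ i j) (row i j j′ j≤j′)) ,
      (λ i i′ j i≤i′ → subst₂ _≤ᶠ_ (π≈ρ i′ j) (π≈ρ i j) (col i i′ j i≤i′)))
    (allArrays-enumerates b a (suc c))

  SSYTs-enumerates :
    Enumerates (arrays b a (b + c)) (λ T → ⊤ × IsSSYT T) (SSYTs a b (b + c))
  SSYTs-enumerates = filter-enumerates _ isSSYT?
    (λ T≈U (row , col) →
      (λ i j j′ j≤j′ → subst₂ _≤ᶠ_ (T≈U i j) (T≈U i j′) (row i j j′ j≤j′)) ,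
      (λ i i′ j i<i′ → subst₂ _<ᶠ_ (T≈U i j) (T≈U i′ j) (col i i′ j i<i′)))
    (allArrays-enumerates b a (b + c))

  toTableau-cong : ∀ {π ρ} → π ≈ ρ → toTableau π ≈ toTableau ρ
  toTableau-cong π≈ρ = tableau-cong (through-cong (to-cong RSK) π≈ρ)

  fromTableau-cong : ∀ {T U} → T ≈ U → fromTableau T ≈ fromTableau U
  fromTableau-cong {T} {U} T≈U = through-cong (from-cong RSK) (untableau-cong {b} {a} {c} {T} {U} T≈U)

  toTableau-SSYT : ∀ {π} → IsPlanePartition π → IsSSYT (toTableau π)
  toTableau-SSYT pp = tableau-SSYT (through-planePartition (to-boxed RSK) pp)

  fromTableau-planePartition : ∀ {T} → IsSSYT T → IsPlanePartition (fromTableau T)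
  fromTableau-planePartition ssyt = through-planePartition (from-boxed RSK) (untableau-planePartition ssyt)

  fromTableau-toTableau : ∀ {π} → IsPlanePartition π → fromTableau (toTableau π) ≈ π
  fromTableau-toTableau {π} pp i j = trans
    (through-cong (from-cong RSK) (untableau-tableau (through (to RSK) π)) i j)
    (through-inverse (to-boxed RSK) pp (from-cong RSK) (from-to RSK) i j)

  toTableau-fromTableau : ∀ {T} → IsSSYT T → toTableau (fromTableau T) ≈ T
  toTableau-fromTableau ssyt i j = trans
    (tableau-cong (through-inverse (from-boxed RSK) (untableau-planePartition ssyt) (to-cong RSK) (to-from RSK)) i j)
    (tableau-untableau ssyt i j)

  Γ-fromTableau : ∀ {T} → IsSSYT T → ∀ ℓ → Γ (fromTableau T) ℓ ≡ content T (b ↑ʳ ℓ)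
  Γ-fromTableau ssyt ℓ = trans (sym (content-toTableau (fromTableau-planePartition ssyt) ℓ))
    (content-cong (toTableau-fromTableau ssyt) (b ↑ʳ ℓ))

  length-planePartitions : length (planePartitions a b c) ≡ schurAtOnes a b (b + c)
  length-planePartitions = ≤-antisym
    (length≤ PPs Ts planePartitions-enumerates SSYTs-enumerates toTableau fromTableau
      (λ (_ , pp) → tt , toTableau-SSYT pp) (λ {T} {U} → fromTableau-cong {T} {U}) (λ (_ , pp) → fromTableau-toTableau pp))
    (length≤ Ts PPs SSYTs-enumerates planePartitions-enumerates fromTableau toTableau
      (λ (_ , ssyt) → tt , fromTableau-planePartition ssyt) toTableau-cong (λ (_ , ssyt) → toTableau-fromTableau ssyt))
    where
    PPs = arrays b a (suc c)
    Ts  = arrays b a (b + c)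

  -- The bijection restricts to the arrays with prescribed statistic `γ`, because it carries `Γ` to
  -- the content in both directions.
  count-ΓIs : ∀ γ → count (ΓIs? γ) (planePartitions a b c) ≡ schurSpecCoeff a b c γ
  count-ΓIs γ = ≤-antisym
    (length≤ PPs Ts E F toTableau fromTableau
      (λ ((_ , pp) , is) → (tt , toTableau-SSYT pp) , λ ℓ → trans (content-toTableau pp ℓ) (is ℓ))
      (λ {T} {U} → fromTableau-cong {T} {U}) (λ ((_ , pp) , _) → fromTableau-toTableau pp))
    (length≤ Ts PPs F E fromTableau toTableau
      (λ ((_ , ssyt) , is) → (tt , fromTableau-planePartition ssyt) , λ ℓ → trans (Γ-fromTableau ssyt ℓ) (is ℓ))
      toTableau-cong (λ ((_ , ssyt) , _) → toTableau-fromTableau ssyt))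
    where
    PPs = arrays b a (suc c)
    Ts  = arrays b a (b + c)
    E = filter-enumerates PPs (ΓIs? γ) (λ π≈ρ is ℓ → trans (sym (Γ-cong π≈ρ ℓ)) (is ℓ)) planePartitions-enumerates
    F = filter-enumerates Ts (ContentIs? γ) (λ T≈U is ℓ → trans (sym (content-cong T≈U (b ↑ʳ ℓ))) (is ℓ)) SSYTs-enumerates

theorem5p1 : (a b c : ℕ) → 1 ≤ a → 1 ≤ b → 1 ≤ c →
    (γ : Fin c → ℕ) → probΓ a b c γ ≡ normSchurCoeff a b c γ
-- Numerators and denominators agree separately.
theorem5p1 a b c _ _ _ γ = cong₂ frac (count-ΓIs {b} {a} {c} γ) (length-planePartitions {b} {a} {c})
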